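{- Let $R$ be a commutative ring containing elements $p,q,\hbar,t_1,\dots,t_n$, and let $\mathcal M$ be the free $R$-module with basis the partitions $\nu\subseteq(n-k)^k$. For $1\le i\le k$ and $\nu\subseteq(n-k)^k$, with $c=\nu_i+k+1-i$, define $R$-linear operators by $$A^{h,h}_i(\nu)=t_c\nu+\sum_{\mu}w_{\mathtt h}(\mu/\nu)\,\mu,\quad A^{h,t}_i(\nu)=t_c\nu+\sum_{\mu}w_{\mathtt t}(\mu/\nu)\,\mu\quad(\mu/\nu\text{ a ribbon with head in row }i),$$ $$A^{t,h}_i(\nu)=t_c\nu+\sum_{\mu}w_{\mathtt h}(\mu/\nu)\,\mu,\quad A^{t,t}_i(\nu)=t_c\nu+\sum_{\mu}w_{\mathtt t}(\mu/\nu)\,\mu\quad(\mu/\nu\text{ a ribbon with tail in row }i),$$ and $$B^{h,h}_i(\nu)=t_c\nu+\sum_{\lambda}w_{\mathtt h}(\nu/\lambda)\,\lambda,\quad B^{h,t}_i(\nu)=t_c\nu+\sum_{\lambda}w_{\mathtt t}(\nu/\lambda)\,\lambda\quad(\nu/\lambda\text{ a ribbon with head in row }i),$$ $$B^{t,h}_i(\nu)=t_c\nu+\sum_{\lambda}w_{\mathtt h}(\nu/\lambda)\,\lambda,\quad B^{t,t}_i(\nu)=t_c\nu+\sum_{\lambda}w_{\mathtt t}(\nu/\lambda)\,\lambda\quad(\nu/\lambda\text{ a ribbon with tail in row }i),$$ all sums over partitions inside $(n-k)^k$, where for a ribbon $\eta$, $w_{\mathtt h}(\eta)=(\hbar-(p-q)t_{\mathtt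 h(\eta)})p^{\operatorname{ht}(\eta)-1}q^{\operatorname{wd}(\eta)-1}$ and $w_{\mathtt t}(\eta)=(\hbar-(p-q)t_{\mathtt t(\eta)})p^{\operatorname{ht}(\eta)-1}q^{\operatorname{wd}(\eta)-1}$. Then for all $\lambda,\mu\subseteq(n-k)^k$ and $0\le r\le k$, with all sums over $1\le i_1<\cdots<i_r\le k$: $$\sum A^{h,h}_{i_r}\cdots A^{h,h}_{i_1}(\lambda)=\sum A^{t,h}_{i_r}\cdots A^{t,h}_{i_1}(\lambda),\qquad \sum A^{h,t}_{i_r}\cdots A^{h,t}_{i_1}(\lambda)=\sum A^{t,t}_{i_r}\cdots A^{t,t}_{i_1}(\lambda),$$ $$\sum B^{h,h}_{i_1}\cdots B^{h,h}_{i_r}(\mu)=\sum B^{t,h}_{i_1}\cdots B^{t,h}_{i_r}(\mu),\qquad \sum B^{h,t}_{i_1}\cdots B^{h,t}_{i_r}(\mu)=\sum B^{t,t}_{i_1}\cdots B^{t,t}_{i_r}(\mu).$$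
   Context: Partitions $\nu\subseteq(n-k)^k$: $n-k\ge\nu_1\ge\dots\ge\nu_k\ge0$, identified with Young diagrams, rows numbered top to bottom. A ribbon is a nonempty connected skew shape $\eta=\mu/\lambda$ containing no $2\times2$ square; head = top-right box, tail = bottom-left box; $\operatorname{ht}(\eta)$, $\operatorname{wd}(\eta)$ are its numbers of rows and columns. If the head is in row $i$ and the tail in row $j$, $\mathtt h(\eta)=\mu_i+k+1-i$ and $\mathtt t(\eta)=\lambda_j+k+1-j$. -}

module Defs where

open import Algebra.Bundles using (CommutativeRing)
import Algebra.Properties.Semiring.Exp as Exp
open import Data.Fin.Base as Fin using (Fin; zero; suc; toℕ; fromℕ<; opposite)
open import Data.Fin.Properties as Fin using (any?; all?)
open import Data.List.Base using (List; []; _∷_; allFin; cartesianProduct; cartesianProductWith; filter; foldr; length; mapMaybe)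
open import Data.List.Membership.Propositional using (_∈_)
open import Data.List.Membership.Propositional.Properties using (∈-allFin; ∈-cartesianProductWith⁺; ∈-cartesianProduct⁺)
open import Data.List.Relation.Unary.All using (All; []; _∷_)
open import Data.List.Relation.Unary.AllPairs using ([]; _∷_)
open import Data.List.Relation.Unary.Unique.Propositional using (Unique)
import Data.List.Relation.Unary.Unique.Propositional.Properties as Unique
open import Data.List.Relation.Unary.Any using (here; there)
open import Data.Maybe.Base using (Maybe; just; nothing)
open import Data.Nat.Base as ℕ using (ℕ; zero; suc; z≤n; s≤s; s≤s⁻¹; ∣_-_∣)
import Data.Nat.Properties as ℕ
open import Data.Product.Base using (∃; _×_; _,_; proj₁; proj₂)
open import Data.Product.Properties using (≡-dec)
open import Data.Sum.Base using (_⊎_; inj₁; inj₂)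
open import Data.Vec.Base using (Vec; []; _∷_; lookup)
import Data.Vec.Properties as Vec
open import Data.Vec.Relation.Unary.Linked using (Linked; linked?)
import Data.Vec.Relation.Unary.Linked.Properties as Linked
open import Level using (Level)
open import Relation.Binary.Construct.Closure.ReflexiveTransitive using (Star; ε; _◅_; _◅◅_)
open import Relation.Binary.Definitions using (Decidable; DecidableEquality)
open import Relation.Binary.PropositionalEquality using (_≡_; _≢_; refl; cong; subst)
open import Relation.Nullary.Decidable using (Dec; yes; no; map′; _×-dec_; _⊎-dec_; _→-dec_; ¬?; recompute)
open import Relation.Nullary.Negation using (¬_; contradiction)
import Relation.Unary as Unary

vectors : ∀ m k → List (Vec (Fin m) k)
vectors m zero    = [] ∷ []
vectors m (suc k) = cartesianProductWith _∷_ (allFin m) (vectors m k)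

-- The sequences i₁ < ⋯ < iᵣ in Fin k.
increasing : ∀ k r → List (Vec (Fin k) r)
increasing k r = filter (linked? Fin._<?_) (vectors k r)

least : ∀ {n} {P : Fin n → Set} → Unary.Decidable P → ∃ P →
        ∃ λ i → P i × (∀ j → P j → i Fin.≤ j)
least {suc _} P? (i , pi) with P? zero
least {suc _} P? (i     , pi) | yes p = zero , p , λ _ _ → z≤n
least {suc _} P? (zero  , pi) | no ¬p = contradiction pi ¬p
least {suc _} P? (suc i , pi) | no ¬p with least (λ j → P? (suc j)) (i , pi)
... | l , pl , l≤ = suc l , pl , λ where
  zero    p0 → contradiction p0 ¬p
  (suc j) pj → s≤s (l≤ j pj)

greatest : ∀ {n} {P : Fin n → Set} → Unary.Decidable P → ∃ P →
           ∃ λ i → P i × (∀ j → P j → j Fin.≤ i)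
greatest {suc _} P? (i , pi) with any? (λ j → P? (suc j))
greatest {suc _} P? (i , pi) | yes e with greatest (λ j → P? (suc j)) e
... | g , pg , ≤g = suc g , pg , λ where
  zero    _  → z≤n
  (suc j) pj → s≤s (≤g j pj)
greatest {suc _} P? (zero  , pi) | no ¬e = zero , pi , λ where
  zero    _  → z≤n
  (suc j) pj → contradiction (j , pj) ¬e
greatest {suc _} P? (suc i , pi) | no ¬e = contradiction (i , pi) ¬e

-- Decidability of reachability in a finite graph, by Warshall's algorithm.
module Reachability {A : Set} (_≟_ : DecidableEquality A)
                    {_~_ : A → A → Set} (_~?_ : Decidable _~_) where

  Via : List A → A → A → Set
  Via []       x y = x ≡ y ⊎ x ~ y
  Via (v ∷ vs) x y = Via vs x y ⊎ Via vs x v × Via vs v y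

  via? : ∀ vs → Decidable (Via vs)
  via? []       x y = (x ≟ y) ⊎-dec (x ~? y)
  via? (v ∷ vs) x y = via? vs x y ⊎-dec (via? vs x v ×-dec via? vs v y)

  sound : ∀ vs {x y} → Via vs x y → Star _~_ x y
  sound []       (inj₁ refl)    = ε
  sound []       (inj₂ x~y)     = x~y ◅ ε
  sound (v ∷ vs) (inj₁ xy)      = sound vs xy
  sound (v ∷ vs) (inj₂ (a , b)) = sound vs a ◅◅ sound vs b

  base : ∀ vs {x y} → x ≡ y ⊎ x ~ y → Via vs x y
  base []       e = e
  base (v ∷ vs) e = inj₁ (base vs e)

  join : ∀ {vs z} → z ∈ vs → ∀ {x y} → Via vs x z → Via vs z y → Via vs x y
  join (here refl) a b = inj₂ (into a , out b)
    where
    into : ∀ {v vs x} → Via (v ∷ vs) x v → Via vs x v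
    into (inj₁ a)       = a
    into (inj₂ (a , _)) = a
    out : ∀ {v vs y} → Via (v ∷ vs) v y → Via vs v y
    out (inj₁ b)       = b
    out (inj₂ (_ , b)) = b
  join (there z∈) (inj₁ a)       (inj₁ b)       = inj₁ (join z∈ a b)
  join (there z∈) (inj₁ a)       (inj₂ (b , c)) = inj₂ (join z∈ a b , c)
  join (there z∈) (inj₂ (a , b)) (inj₁ c)       = inj₂ (a , join z∈ b c)
  join (there z∈) (inj₂ (a , _)) (inj₂ (_ , c)) = inj₂ (a , c)

  module _ (vs : List A) (all∈ : ∀ x → x ∈ vs) where

    complete : ∀ {x y} → Star _~_ x y → Via vs x y
    complete ε         = base vs (inj₁ refl)
    complete (e ◅ es)  = join (all∈ _) (base vs (inj₂ e)) (complete es)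

    star? : Decidable (Star _~_)
    star? x y = map′ (sound vs) complete (via? vs x y)

-- Partitions with k parts, all at most m.  Rows and columns are numbered from 0.
record Partition (m k : ℕ) : Set where
  constructor mkPartition
  field
    parts       : Vec (Fin (suc m)) k
    .decreasing : Linked Fin._≥_ parts

  part : Fin k → ℕ
  part i = toℕ (lookup parts i)

open Partition public

module _ {m k : ℕ} where

  decreasing? : (v : Vec (Fin (suc m)) k) → Dec (Linked Fin._≥_ v)
  decreasing? = linked? (λ i j → j Fin.≤? i)

  toPartition : Vec (Fin (suc m)) k → Maybe (Partition m k)
  toPartition v with decreasing? v
  ... | yes d = just (mkPartition v d)
  ... | no  _ = nothing

  _≟ᴾ_ : DecidableEquality (Partition m k)
  mkPartition u _ ≟ᴾ mkPartition v _ =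
    map′ (λ { refl → refl }) (cong parts) (Vec.≡-dec Fin._≟_ u v)

  parts-decreasing : (ν : Partition m k) → Linked Fin._≥_ (parts ν)
  parts-decreasing (mkPartition v d) = recompute (decreasing? v) d

  part-mono : (ν : Partition m k) {i j : Fin k} → i Fin.≤ j → part ν j ℕ.≤ part ν i
  part-mono ν {i} {j} i≤j with i Fin.≟ j
  ... | yes refl = ℕ.≤-refl
  ... | no  i≢j  = Linked.lookup⁺ (λ a b → ℕ.≤-trans b a)
                     (parts-decreasing ν)
                     (Fin.≤∧≢⇒< i≤j i≢j)

partitions : ∀ m k → List (Partition m k)
partitions m k = mapMaybe toPartition (vectors (suc m) k)

∈-vectors : ∀ {m k} (v : Vec (Fin m) k) → v ∈ vectors m k
∈-vectors []       = here refl
∈-vectors (i ∷ is) = ∈-cartesianProductWith⁺ _∷_ (∈-allFin i) (∈-vectors is)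

vectors-unique : ∀ m k → Unique (vectors m k)
vectors-unique m zero    = [] ∷ []
vectors-unique m (suc k) = Unique.cartesianProductWith⁺ _∷_ Vec.∷-injective
  (Unique.allFin⁺ m) (vectors-unique m k)

∈-partitions : ∀ {m k} (ν : Partition m k) → ν ∈ partitions m k
∈-partitions {m} {k} ν = search (∈-vectors (parts ν))
  where
  search : ∀ {vs} → parts ν ∈ vs → ν ∈ mapMaybe toPartition vs
  search (here refl) with decreasing? (parts ν)
  ... | yes _ = here refl
  ... | no ¬d = contradiction (parts-decreasing ν) ¬d
  search {v ∷ _} (there ν∈) with decreasing? v
  ... | yes _ = there (search ν∈)
  ... | no  _ = search ν∈

partitions-unique : ∀ m k → Unique (partitions m k)
partitions-unique m k = go (vectors-unique (suc m) k)
  where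
  fresh : ∀ {v vs} → All (v ≢_) vs → .(d : Linked Fin._≥_ v) →
          All (mkPartition v d ≢_) (mapMaybe toPartition vs)
  fresh []                     d = []
  fresh {vs = w ∷ _} (v≢w ∷ f) d with decreasing? w
  ... | yes _ = (λ e → v≢w (cong parts e)) ∷ fresh f d
  ... | no  _ = fresh f d
  go : ∀ {vs} → Unique vs → Unique (mapMaybe toPartition vs)
  go []                  = []
  go {v ∷ _} (v∉ ∷ uniq) with decreasing? v
  ... | yes d = fresh v∉ d ∷ go uniq
  ... | no  _ = go uniq

Box : (m k : ℕ) → Set
Box m k = Fin k × Fin m

module _ {m k : ℕ} where

  boxes : List (Box m k)
  boxes = cartesianProduct (allFin k) (allFin m)

  ∈-boxes : (x : Box m k) → x ∈ boxes
  ∈-boxes (i , j) = ∈-cartesianProduct⁺ (∈-allFin i) (∈-allFin j)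

  infix 4 _∈[_/_] _∈?[_/_]

  _∈[_/_] : Box m k → Partition m k → Partition m k → Set
  (i , j) ∈[ μ / ν ] = part ν i ℕ.≤ toℕ j × toℕ j ℕ.< part μ i

  _∈?[_/_] : ∀ x μ ν → Dec (x ∈[ μ / ν ])
  (i , j) ∈?[ μ / ν ] = (part ν i ℕ.≤? toℕ j) ×-dec (toℕ j ℕ.<? part μ i)

  -- Two boxes share an edge iff their Manhattan distance is 1.
  Adjacent : Box m k → Box m k → Set
  Adjacent (i , j) (i′ , j′) = ∣ toℕ i - toℕ i′ ∣ ℕ.+ ∣ toℕ j - toℕ j′ ∣ ≡ 1

  Step : Partition m k → Partition m k → Box m k → Box m k → Set
  Step μ ν x y = x ∈[ μ / ν ] × y ∈[ μ / ν ] × Adjacent x y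

  Connected : Partition m k → Partition m k → Set
  Connected μ ν = ∀ x y → x ∈[ μ / ν ] → y ∈[ μ / ν ] → Star (Step μ ν) x y

  -- The 2 × 2 square with rows i, i′ = i + 1 and columns j, j′ = j + 1.
  Square : Partition m k → Partition m k → Fin k → Fin k → Fin m → Fin m → Set
  Square μ ν i i′ j j′ = toℕ i′ ≡ suc (toℕ i) × toℕ j′ ≡ suc (toℕ j)
    × (i  , j) ∈[ μ / ν ] × (i  , j′) ∈[ μ / ν ]
    × (i′ , j) ∈[ μ / ν ] × (i′ , j′) ∈[ μ / ν ]

  record IsRibbon (μ ν : Partition m k) : Set where
    constructor mkRibbon
    field
      contained : ∀ i → part ν i ℕ.≤ part μ i
      nonempty  : ∃ λ x → x ∈[ μ / ν ]
      connected : Connected μ ν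
      no-square : ∀ i i′ j j′ → ¬ Square μ ν i i′ j j′

  IsHead IsTail : Partition m k → Partition m k → Box m k → Set
  IsHead μ ν x = x ∈[ μ / ν ] ×
    (∀ y → y ∈[ μ / ν ] → proj₁ x Fin.≤ proj₁ y × proj₂ y Fin.≤ proj₂ x)
  IsTail μ ν x = x ∈[ μ / ν ] ×
    (∀ y → y ∈[ μ / ν ] → proj₁ y Fin.≤ proj₁ x × proj₂ x Fin.≤ proj₂ y)

  module _ (μ ν : Partition m k) where

    rowMeets? : ∀ i → Dec (∃ λ j → (i , j) ∈[ μ / ν ])
    rowMeets? i = any? λ j → (i , j) ∈?[ μ / ν ]

    colMeets? : ∀ j → Dec (∃ λ i → (i , j) ∈[ μ / ν ])
    colMeets? j = any? λ i → (i , j) ∈?[ μ / ν ]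

    ht wd : ℕ
    ht = length (filter rowMeets? (allFin k))
    wd = length (filter colMeets? (allFin m))

    allBoxes? : {P : Box m k → Set} → Unary.Decidable P → Dec (∀ x → P x)
    allBoxes? P? = map′ (λ f (i , j) → f i j) (λ f i j → f (i , j))
                     (all? λ i → all? λ j → P? (i , j))

    step? : Decidable (Step μ ν)
    step? x@(i , j) y@(i′ , j′) = (x ∈?[ μ / ν ]) ×-dec (y ∈?[ μ / ν ]) ×-dec
      (∣ toℕ i - toℕ i′ ∣ ℕ.+ ∣ toℕ j - toℕ j′ ∣ ℕ.≟ 1)

    connected? : Dec (Connected μ ν)
    connected? = allBoxes? λ x → allBoxes? λ y →
      (x ∈?[ μ / ν ]) →-dec ((y ∈?[ μ / ν ]) →-dec star? boxes ∈-boxes x y)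
      where open Reachability (≡-dec Fin._≟_ Fin._≟_) step?

    square? : ∀ i i′ j j′ → Dec (Square μ ν i i′ j j′)
    square? i i′ j j′ = (toℕ i′ ℕ.≟ suc (toℕ i)) ×-dec (toℕ j′ ℕ.≟ suc (toℕ j))
      ×-dec ((i  , j) ∈?[ μ / ν ]) ×-dec ((i  , j′) ∈?[ μ / ν ])
      ×-dec ((i′ , j) ∈?[ μ / ν ]) ×-dec ((i′ , j′) ∈?[ μ / ν ])

    isRibbon? : Dec (IsRibbon μ ν)
    isRibbon? = map′
      (λ (a , (i , j , x∈) , c , d) → mkRibbon a ((i , j) , x∈) c d)
      (λ (mkRibbon a ((i , j) , x∈) c d) → a , (i , j , x∈) , c , d)
      ((all? λ i → part ν i ℕ.≤? part μ i)
        ×-dec (any? rowMeets?)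
        ×-dec connected?
        ×-dec (all? λ i → all? λ i′ → all? λ j → all? λ j′ → ¬? (square? i i′ j j′)))

  module _ {μ ν : Partition m k} (η : IsRibbon μ ν) where
    open IsRibbon η

    hasHead : ∃ (IsHead μ ν)
    hasHead with nonempty
    ... | (a , b) , ab∈ with least (rowMeets? μ ν) (a , b , ab∈)
    ... | i , meets , i≤ with greatest (λ j → (i , j) ∈?[ μ / ν ]) meets
    ... | j , ij∈@(ν≤j , _) , ≤j = (i , j) , ij∈ , λ (i′ , j′) y∈ → i≤ i′ (j′ , y∈) , right i′ j′ y∈
      where
      right : ∀ i′ j′ → (i′ , j′) ∈[ μ / ν ] → j′ Fin.≤ j
      right i′ j′ y∈@(_ , j′<μ) with j′ Fin.≤? j
      ... | yes j′≤j = j′≤j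
      ... | no  j′≰j = ≤j j′ ( ℕ.≤-trans ν≤j (ℕ.<⇒≤ (ℕ.≰⇒> j′≰j))
                             , ℕ.<-≤-trans j′<μ (part-mono μ (i≤ i′ (j′ , y∈))))

    hasTail : ∃ (IsTail μ ν)
    hasTail with nonempty
    ... | (a , b) , ab∈ with greatest (rowMeets? μ ν) (a , b , ab∈)
    ... | i , meets , ≤i with least (λ j → (i , j) ∈?[ μ / ν ]) meets
    ... | j , ij∈@(_ , j<μ) , j≤ = (i , j) , ij∈ , λ (i′ , j′) y∈ → ≤i i′ (j′ , y∈) , left i′ j′ y∈
      where
      left : ∀ i′ j′ → (i′ , j′) ∈[ μ / ν ] → j Fin.≤ j′
      left i′ j′ y∈@(ν≤j′ , _) with j Fin.≤? j′
      ... | yes j≤j′ = j≤j′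
      ... | no  j≰j′ = j≤ j′ ( ℕ.≤-trans (part-mono ν (≤i i′ (j′ , y∈))) ν≤j′
                             , ℕ.<-trans (ℕ.≰⇒> j≰j′) j<μ)

    headRow tailRow : Fin k
    headRow = proj₁ (proj₁ hasHead)
    tailRow = proj₁ (proj₁ hasTail)

data End : Set where
  h t : End

endRow : ∀ {m k} {μ ν : Partition m k} → End → IsRibbon μ ν → Fin k
endRow h = headRow
endRow t = tailRow

-- τ is the family t₁, …, tₙ, with t_c at position c - 1.
module Operators {c ℓ : Level} (R : CommutativeRing c ℓ) (n k : ℕ) (k≤n : k ℕ.≤ n)
                 (p q ħ : CommutativeRing.Carrier R)
                 (τ : Fin n → CommutativeRing.Carrier R) where

  open CommutativeRing R using (Carrier; _≈_; _+_; _*_; _-_; 0#; 1#; semiring)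
  open Exp semiring using (_^_)

  Part : Set
  Part = Partition (n ℕ.∸ k) k

  -- The 1-based index νᵢ + k + 1 - i with 1 ≤ i ≤ k becomes, with i and the
  -- index both counted from 0, the element νᵢ + (k - 1 - i) of Fin n.
  index : Part → Fin k → Fin n
  index ν i = fromℕ< {part ν i ℕ.+ toℕ (opposite i)} bound
    where
    bound : part ν i ℕ.+ toℕ (opposite i) ℕ.< n
    bound = subst (part ν i ℕ.+ toℕ (opposite i) ℕ.<_) (ℕ.m∸n+n≡m k≤n)
              (ℕ.+-mono-≤-< (s≤s⁻¹ (Fin.toℕ<n (lookup (parts ν) i))) (Fin.toℕ<n (opposite i)))

  endIndex : {μ ν : Part} → End → IsRibbon μ ν → Fin n
  endIndex {μ} {ν} h η = index μ (headRow η)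
  endIndex {μ} {ν} t η = index ν (tailRow η)

  weight : {μ ν : Part} → End → IsRibbon μ ν → Carrier
  weight {μ} {ν} b η =
    (ħ - (p - q) * τ (endIndex b η)) * p ^ (ht μ ν ℕ.∸ 1) * q ^ (wd μ ν ℕ.∸ 1)

  -- The free module on the finite set Part, an element being its family of coordinates.
  M : Set c
  M = Part → Carrier

  infix  4 _≈ᴹ_
  infixl 6 _+ᴹ_
  infixr 7 _•_

  _≈ᴹ_ : M → M → Set ℓ
  u ≈ᴹ v = ∀ ν → u ν ≈ v ν

  0ᴹ : M
  0ᴹ _ = 0#

  _+ᴹ_ : M → M → M
  (u +ᴹ v) ν = u ν + v ν

  _•_ : Carrier → M → M
  (a • v) ν = a * v ν

  basis : Part → M
  basis ν μ with ν ≟ᴾ μ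
  ... | yes _ = 1#
  ... | no  _ = 0#

  ∑ : ∀ {a} {A : Set a} → List A → (A → M) → M
  ∑ xs f = foldr (λ x v → f x +ᴹ v) 0ᴹ xs

  linear : (Part → M) → M → M
  linear φ v = ∑ (partitions (n ℕ.∸ k) k) λ ν → v ν • φ ν

  -- The weight of μ/ν (with τ taken at end b) if μ/ν is a ribbon whose end a is in row i, else 0.
  coefficient : End → End → Fin k → Part → Part → Carrier
  coefficient a b i μ ν with isRibbon? μ ν
  ... | no  _ = 0#
  ... | yes η with endRow a η Fin.≟ i
  ...   | yes _ = weight b η
  ...   | no  _ = 0#

  A B : End → End → Fin k → M → M
  A a b i = linear λ ν → τ (index ν i) • basis ν
    +ᴹ ∑ (partitions (n ℕ.∸ k) k) λ μ → coefficient a b i μ ν • basis μ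
  B a b i = linear λ ν → τ (index ν i) • basis ν
    +ᴹ ∑ (partitions (n ℕ.∸ k) k) λ κ → coefficient a b i ν κ • basis κ

  -- F iᵣ ∘ ⋯ ∘ F i₁
  composeDown : ∀ {r} → (Fin k → M → M) → Vec (Fin k) r → M → M
  composeDown F []       v = v
  composeDown F (i ∷ is) v = composeDown F is (F i v)

  -- F i₁ ∘ ⋯ ∘ F iᵣ
  composeUp : ∀ {r} → (Fin k → M → M) → Vec (Fin k) r → M → M
  composeUp F []       v = v
  composeUp F (i ∷ is) v = F i (composeUp F is v)

{-# OPTIONS --safe #-}
module Submission where

-- A partition is read as a configuration of k particles on n sites, row i being the i-th
-- particle from the right, at site νᵢ + k - 1 - i.  Adding a ribbon moves one particle from a
-- site x to an empty site y > x: the tail row counts the particle before the move, the head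
-- row after it, and the weight has a factor p for every particle and q for every hole between
-- x and y.  Let T i and H i be the operators for the tail and the head in row i.
--
-- Peel off the rightmost site.  In the product of the 1 + z H i the particle that ends on it
-- arrives there in the first factor.  In the product of the 1 + z T i it arrives in some
-- factor i; but the factors before that one move particles to the right of row i, which
-- commutes with taking particle i away, because the weight of the jump of particle i to the
-- last site does not change.  So it may arrive first here as well, and both products satisfy
-- the same recursion on n.  Below, g x y stands for the factor ħ - (p - q)t of the weight.
-- The operators B are the transposes of the operators A.

open import Algebra.Bundles using (CommutativeRing)
import Algebra.Properties.Semiring.Exp as Exp
import Algebra.Solver.Ring.NaturalCoefficients.Default as RingSolver
open import Data.Bool.Base using (Bool; true; false; if_then_else_)
open import Data.Fin.Base as Fin using (Fin; zero; suc; toℕ; fromℕ<; inject₁)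
import Data.Fin.Properties as Fin
open import Data.List.Base as List using (List; []; _∷_; _++_; length; filter)
open import Data.List.Membership.Propositional using (_∈_)
import Data.List.Membership.Propositional.Properties as ∈
open import Data.List.Membership.Propositional.Properties.WithK using (unique∧set⇒bag)
open import Data.List.Relation.Binary.BagAndSetEquality using (∼bag⇒↭)
open import Data.List.Relation.Binary.Permutation.Propositional as ↭ using (_↭_)
import Data.List.Relation.Unary.All as All
open import Data.List.Relation.Unary.AllPairs using ([]; _∷_)
open import Data.List.Relation.Unary.Any using (here; there)
open import Data.List.Relation.Unary.Unique.Propositional using (Unique)
import Data.List.Relation.Unary.Unique.Propositional.Properties as Unique
open import Data.Nat.Base as ℕ using (ℕ; zero; suc; pred; z≤n; s≤s; _≤_; _∸_; _≡ᵇ_; ∣_-_∣)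
import Data.Nat.Properties as ℕ
open import Data.Product.Base using (∃; _×_; _,_; proj₁; proj₂)
open import Data.Sum.Base using (inj₁; inj₂)
open import Data.Vec.Base as Vec using (Vec; []; _∷_; lookup)
import Data.Vec.Properties as Vec
open import Data.Vec.Relation.Unary.Linked as Linked using (Linked; []; [-]; _∷_; linked?)
import Data.Vec.Relation.Unary.Linked.Properties as Linked
open import Function.Base using (_∘_; id)
open import Function.Bundles using (mk⇔)
open import Level using (Level; _⊔_)
open import Relation.Binary.Construct.Closure.ReflexiveTransitive as Star using (Star; ε; _◅_; _◅◅_)
open import Relation.Binary.PropositionalEquality as ≡ using (_≡_; _≢_)
import Relation.Binary.Reasoning.Setoid as SetoidReasoning
open import Relation.Nullary.Decidable using (yes; no)
open import Relation.Nullary.Negation using (¬_; contradiction)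
import Relation.Unary as Unary
open import Defs

-- The head of the vector is the rightmost site, so a site is numbered by the length of
-- the tail after it.
Config : ℕ → Set
Config = Vec Bool

pattern ● = true
pattern ○ = false

particles : ∀ {n} → Config n → ℕ
particles []      = 0
particles (● ∷ c) = suc (particles c)
particles (○ ∷ c) = particles c

-- Linear operators on functions of configurations, and sums over increasing indices.

module Functions {c ℓ} (R : CommutativeRing c ℓ) where

  open CommutativeRing R hiding (zero)
  open RingSolver commutativeSemiring using (solve; _:=_; _:+_; _:*_)
  open SetoidReasoning setoid

  -- Functions serve as coordinate vectors: an operator evaluated at `c` collects the contributions
  -- of all sources from which `c` is reached, so composites act from the inside out.
  Fun : ℕ → Set c
  Fun n = Config n → Carrier

  Op : ℕ → Set c
  Op n = Fun n → Fun n

  infix 4 _≋_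
  _≋_ : ∀ {n} → Fun n → Fun n → Set ℓ
  u ≋ v = ∀ c → u c ≈ v c

  infixl 6 _⊕_
  infixr 7 _⊙_

  0ᶠ : ∀ {n} → Fun n
  0ᶠ _ = 0#

  _⊕_ : ∀ {n} → Fun n → Fun n → Fun n
  (u ⊕ v) c = u c + v c

  _⊙_ : ∀ {n} → Carrier → Fun n → Fun n
  (a ⊙ u) c = a * u c

  record Linear {n} (F : Op n) : Set (c ⊔ ℓ) where
    field
      cong   : ∀ {u v} → u ≋ v → F u ≋ F v
      linear : ∀ a u v → F (a ⊙ u ⊕ v) ≋ a ⊙ F u ⊕ F v

    additive : ∀ u v → F (u ⊕ v) ≋ F u ⊕ F v
    additive u v c = begin
      F (u ⊕ v) c       ≈⟨ cong (λ d → +-congʳ (*-identityˡ (u d))) c ⟨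
      F (1# ⊙ u ⊕ v) c  ≈⟨ linear 1# u v c ⟩
      1# * F u c + F v c ≈⟨ +-congʳ (*-identityˡ _) ⟩
      F u c + F v c     ∎

    zero-preserving : F 0ᶠ ≋ 0ᶠ
    zero-preserving c = begin
      F 0ᶠ c                  ≈⟨ cong (λ _ → trans (+-congʳ (zeroʳ _)) (+-identityˡ 0#)) c ⟨
      F ((- 1#) ⊙ 0ᶠ ⊕ 0ᶠ) c  ≈⟨ linear (- 1#) 0ᶠ 0ᶠ c ⟩
      - 1# * F 0ᶠ c + F 0ᶠ c  ≈⟨ +-congˡ (*-identityˡ _) ⟨
      - 1# * F 0ᶠ c + 1# * F 0ᶠ c ≈⟨ distribʳ _ _ _ ⟨
      (- 1# + 1#) * F 0ᶠ c    ≈⟨ *-congʳ (-‿inverseˡ 1#) ⟩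
      0# * F 0ᶠ c             ≈⟨ zeroˡ _ ⟩
      0#                      ∎

    homogeneous : ∀ a u → F (a ⊙ u) ≋ a ⊙ F u
    homogeneous a u c = begin
      F (a ⊙ u) c         ≈⟨ cong (λ d → +-identityʳ _) c ⟨
      F (a ⊙ u ⊕ 0ᶠ) c    ≈⟨ linear a u 0ᶠ c ⟩
      a * F u c + F 0ᶠ c  ≈⟨ +-congˡ (zero-preserving c) ⟩
      a * F u c + 0#      ≈⟨ +-identityʳ _ ⟩
      a * F u c           ∎

  open Linear

  -- Both e₁ F k r and e₂ F k r are ∑ F iᵣ ∘ ⋯ ∘ F i₁ over 0 ≤ i₁ < ⋯ < iᵣ < k: e₁
  -- branches on whether 0 occurs among the indices, e₂ on whether k - 1 does.
  e₁ e₂ : ∀ {n} → (ℕ → Op n) → ℕ → ℕ → Op n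
  e₁ F k       zero    v = v
  e₁ F zero    (suc r) v = 0ᶠ
  e₁ F (suc k) (suc r) v = e₁ (F ∘ suc) k r (F 0 v) ⊕ e₁ (F ∘ suc) k (suc r) v
  e₂ F k       zero    v = v
  e₂ F zero    (suc r) v = 0ᶠ
  e₂ F (suc k) (suc r) v = e₂ F k (suc r) v ⊕ F k (e₂ F k r v)

  module _ {n : ℕ} where

    e₂-cong : {F : ℕ → Op n} → (∀ i → Linear (F i)) → ∀ k r {u v} → u ≋ v → e₂ F k r u ≋ e₂ F k r v
    e₂-cong L k       zero    u≋v = u≋v
    e₂-cong L zero    (suc r) u≋v = λ _ → refl
    e₂-cong L (suc k) (suc r) u≋v = λ c →
      +-cong (e₂-cong L k (suc r) u≋v c) (cong (L k) (e₂-cong L k r u≋v) c)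

    e₂-linear : {F : ℕ → Op n} → (∀ i → Linear (F i)) → ∀ k r → Linear (e₂ F k r)
    e₂-linear L k r .cong = e₂-cong L k r
    e₂-linear L k       zero    .linear a u v = λ _ → refl
    e₂-linear L zero    (suc r) .linear a u v = λ _ → sym (trans (+-identityʳ _) (zeroʳ a))
    e₂-linear {F} L (suc k) (suc r) .linear a u v = λ c → begin
      e₂ F k (suc r) (a ⊙ u ⊕ v) c + F k (e₂ F k r (a ⊙ u ⊕ v)) c
        ≈⟨ +-cong (e₂-linear L k (suc r) .linear a u v c)
                  (trans (cong (L k) (e₂-linear L k r .linear a u v) c) (linear (L k) a _ _ c)) ⟩
      (a * e₂ F k (suc r) u c + e₂ F k (suc r) v c) + (a * F k (e₂ F k r u) c + F k (e₂ F k r v) c)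
        ≈⟨ solve 5 (λ a w x y z → (a :* w :+ x) :+ (a :* y :+ z) := a :* (w :+ y) :+ (x :+ z))
             refl a _ _ _ _ ⟩
      a * (e₂ F k (suc r) u c + F k (e₂ F k r u) c) + (e₂ F k (suc r) v c + F k (e₂ F k r v) c) ∎

    -- This is the recursion that defines `e₁`. By induction on `k`, index 0 is split off in both
    -- summands of `e₂`, and linearity of the last factor carries the splitting through it.
    e₂-first : {F : ℕ → Op n} → (∀ i → Linear (F i)) → ∀ k r v →
               e₂ F (suc k) (suc r) v ≋ e₂ (F ∘ suc) k r (F 0 v) ⊕ e₂ (F ∘ suc) k (suc r) v
    e₂-first L zero zero    v c = +-comm _ _
    e₂-first L zero (suc r) v c = +-congˡ (zero-preserving (L 0) c)
    e₂-first {F} L (suc k) zero v c = begin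
      e₂ F (suc k) 1 v c + F (suc k) v c
        ≈⟨ +-congʳ (e₂-first L k 0 v c) ⟩
      (F 0 v c + e₂ (F ∘ suc) k 1 v c) + F (suc k) v c
        ≈⟨ +-assoc _ _ _ ⟩
      F 0 v c + (e₂ (F ∘ suc) k 1 v c + F (suc k) v c) ∎
    e₂-first {F} L (suc k) (suc r) v c = begin
      e₂ F (suc k) (2 ℕ.+ r) v c + F (suc k) (e₂ F (suc k) (suc r) v) c
        ≈⟨ +-cong (e₂-first L k (suc r) v c)
             (trans (cong (L (suc k)) (e₂-first L k r v) c) (additive (L (suc k)) _ _ c)) ⟩
      (e₂ F′ k (suc r) (F 0 v) c + e₂ F′ k (2 ℕ.+ r) v c)
        + (F′ k (e₂ F′ k r (F 0 v)) c + F′ k (e₂ F′ k (suc r) v) c)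
        ≈⟨ solve 4 (λ w x y z → (w :+ x) :+ (y :+ z) := (w :+ y) :+ (x :+ z)) refl _ _ _ _ ⟩
      (e₂ F′ k (suc r) (F 0 v) c + F′ k (e₂ F′ k r (F 0 v)) c)
        + (e₂ F′ k (2 ℕ.+ r) v c + F′ k (e₂ F′ k (suc r) v) c) ∎
      where F′ = F ∘ suc

    e₁≋e₂ : {F : ℕ → Op n} → (∀ i → Linear (F i)) → ∀ k r v → e₁ F k r v ≋ e₂ F k r v
    e₁≋e₂ L k       zero    v c = refl
    e₁≋e₂ L zero    (suc r) v c = refl
    e₁≋e₂ L (suc k) (suc r) v c = trans
      (+-cong (e₁≋e₂ (L ∘ suc) k r _ c) (e₁≋e₂ (L ∘ suc) k (suc r) v c))
      (sym (e₂-first L k r v c))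

  e₁-cong : ∀ {n} {F : ℕ → Op n} → (∀ i → Linear (F i)) →
            ∀ k r {u v} → u ≋ v → e₁ F k r u ≋ e₁ F k r v
  e₁-cong L k       zero    u≋v = u≋v
  e₁-cong L zero    (suc r) u≋v = λ _ → refl
  e₁-cong L (suc k) (suc r) u≋v = λ c →
    +-cong (e₁-cong (L ∘ suc) k r (cong (L 0) u≋v) c) (e₁-cong (L ∘ suc) k (suc r) u≋v c)

  -- With `f` adding a last site to a configuration, this turns operators on the longer
  -- configuration into operators on the shorter one.
  e₁-∘ : ∀ {m n} {F : ℕ → Op m} {F′ : ℕ → Op n} → (∀ i → Linear (F′ i)) → (f : Config n → Config m) →
         (∀ i v → F i v ∘ f ≋ F′ i (v ∘ f)) → ∀ k r v → e₁ F k r v ∘ f ≋ e₁ F′ k r (v ∘ f)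
  e₁-∘ L f F∘f k       zero    v c = refl
  e₁-∘ L f F∘f zero    (suc r) v c = refl
  e₁-∘ L f F∘f (suc k) (suc r) v c = +-cong
    (trans (e₁-∘ (L ∘ suc) f (F∘f ∘ suc) k r _ c) (e₁-cong (L ∘ suc) k r (F∘f 0 v) c))
    (e₁-∘ (L ∘ suc) f (F∘f ∘ suc) k (suc r) v c)

-- Jump operators and the recursion on the last site.

module Jumps {c ℓ} (R : CommutativeRing c ℓ) (p q : CommutativeRing.Carrier R)
  (τ : ℕ → CommutativeRing.Carrier R) (g : ℕ → ℕ → CommutativeRing.Carrier R) where

  open CommutativeRing R hiding (zero)
  open RingSolver commutativeSemiring using (solve; _:=_; _:+_; _:*_; con)
  open SetoidReasoning setoid
  open Functions R
  open Linear

  -- G b j v c is the total weight of the ways to reach c by taking away the particle in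
  -- row j and sending it to the site b to the right of the configuration.  Rows are
  -- counted from the right.
  G : ∀ {n} → ℕ → ℕ → Op n
  G     b j       v []      = 0#
  -- A hole met here is either passed, with a factor `q`, or the site that the particle has just
  -- left.
  G {suc n} b zero    v (○ ∷ c) = q * G b zero (v ∘ (○ ∷_)) c + g n b * v (● ∷ c)
  G b (suc j) v (○ ∷ c) = q * G b (suc j) (v ∘ (○ ∷_)) c
  G b zero    v (● ∷ c) = 0#
  G b (suc j) v (● ∷ c) = p * G b j (v ∘ (● ∷_)) c

  G< : ∀ {n} → ℕ → ℕ → Op n
  G< b zero    v = 0ᶠ
  G< b (suc j) v = G< b j v ⊕ G b j v

  -- T i and H k i allow one particle to stay, with weight τ, or to jump to the right: for T i
  -- it is in row i before the jump, for H k i it is in row i after the jump and comes from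
  -- one of the rows 0, …, k - 1.
  T : ∀ {n} → ℕ → Op n
  T i       v []      = 0#
  T i       v (○ ∷ c) = T i (v ∘ (○ ∷_)) c
  T {suc n} zero    v (● ∷ c) = τ n * v (● ∷ c) + G n zero (v ∘ (○ ∷_)) c
  T {suc n} (suc i) v (● ∷ c) = T i (v ∘ (● ∷_)) c + G n (suc i) (v ∘ (○ ∷_)) c

  H : ∀ {n} → ℕ → ℕ → Op n
  H k i       v []      = 0#
  H k i       v (○ ∷ c) = H k i (v ∘ (○ ∷_)) c
  H {suc n} k zero    v (● ∷ c) = τ n * v (● ∷ c) + G< n k (v ∘ (○ ∷_)) c
  -- The particle on the last site keeps row 0, so the mover comes from one of the other rows and
  -- both bounds drop by one.
  H k (suc i) v (● ∷ c) = H (pred k) i (v ∘ (● ∷_)) c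

  -- Jumps conserve particles and `G` takes one away. Tracking this number matters because only
  -- configurations with exactly `k` particles come from partitions.
  G-local : ∀ {n} b j {u v : Fun n} c → (∀ d → particles d ≡ suc (particles c) → u d ≈ v d) →
            G b j u c ≈ G b j v c
  G-local b j       []      u≈v = refl
  G-local b zero    (○ ∷ c) u≈v = +-cong (*-congˡ (G-local b zero c λ d → u≈v (○ ∷ d)))
                                         (*-congˡ (u≈v (● ∷ c) ≡.refl))
  G-local b (suc j) (○ ∷ c) u≈v = *-congˡ (G-local b (suc j) c λ d → u≈v (○ ∷ d))
  G-local b zero    (● ∷ c) u≈v = refl
  G-local b (suc j) (● ∷ c) u≈v = *-congˡ (G-local b j c λ d e → u≈v (● ∷ d) (≡.cong suc e))

  G<-local : ∀ {n} b j {u v : Fun n} c → (∀ d → particles d ≡ suc (particles c) → u d ≈ v d) →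
             G< b j u c ≈ G< b j v c
  G<-local b zero    c u≈v = refl
  G<-local b (suc j) c u≈v = +-cong (G<-local b j c u≈v) (G-local b j c u≈v)

  T-local : ∀ {n} i {u v : Fun n} c → (∀ d → particles d ≡ particles c → u d ≈ v d) →
            T i u c ≈ T i v c
  T-local i       []      u≈v = refl
  T-local i       (○ ∷ c) u≈v = T-local i c λ d → u≈v (○ ∷ d)
  T-local zero    (● ∷ c) u≈v = +-cong (*-congˡ (u≈v (● ∷ c) ≡.refl))
                                       (G-local _ zero c λ d → u≈v (○ ∷ d))
  T-local (suc i) (● ∷ c) u≈v = +-cong (T-local i c λ d e → u≈v (● ∷ d) (≡.cong suc e))
                                       (G-local _ (suc i) c λ d → u≈v (○ ∷ d))

  H-local : ∀ {n} k i {u v : Fun n} c → (∀ d → particles d ≡ particles c → u d ≈ v d) →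
            H k i u c ≈ H k i v c
  H-local k i       []      u≈v = refl
  H-local k i       (○ ∷ c) u≈v = H-local k i c λ d → u≈v (○ ∷ d)
  H-local k zero    (● ∷ c) u≈v = +-cong (*-congˡ (u≈v (● ∷ c) ≡.refl))
                                         (G<-local _ k c λ d → u≈v (○ ∷ d))
  H-local k (suc i) (● ∷ c) u≈v = H-local (pred k) i c λ d e → u≈v (● ∷ d) (≡.cong suc e)

  private
    linear-scaled : ∀ s {a x y z} → z ≈ a * x + y → s * z ≈ a * (s * x) + s * y
    linear-scaled s {a} {x} {y} {z} z≈ = trans (*-congˡ z≈)
      (solve 4 (λ s a x y → s :* (a :* x :+ y) := a :* (s :* x) :+ s :* y) refl s a x y)

    linear-0 : ∀ a → 0# ≈ a * 0# + 0#
    linear-0 a = sym (trans (+-identityʳ _) (zeroʳ a))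

    linear-+ : ∀ {a x y z x′ y′ z′} → z ≈ a * x + y → z′ ≈ a * x′ + y′ →
               z + z′ ≈ a * (x + x′) + (y + y′)
    linear-+ {a} {x} {y} {z} {x′} {y′} z≈ z′≈ = trans (+-cong z≈ z′≈)
      (solve 5 (λ a x y x′ y′ → (a :* x :+ y) :+ (a :* x′ :+ y′) := a :* (x :+ x′) :+ (y :+ y′))
         refl a x y x′ y′)

  G-linear : ∀ {n} b j → Linear (G {n} b j)
  G-linear b j .cong u≋v c = G-local b j c λ d _ → u≋v d
  G-linear b j .linear = go j
    where
    go : ∀ {n} j a (u v : Fun n) → G b j (a ⊙ u ⊕ v) ≋ a ⊙ G b j u ⊕ G b j v
    go j       a u v []      = linear-0 a
    go zero    a u v (○ ∷ c) = linear-+ (linear-scaled q (go zero a _ _ c)) (linear-scaled _ refl)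
    go (suc j) a u v (○ ∷ c) = linear-scaled q (go (suc j) a _ _ c)
    go zero    a u v (● ∷ c) = linear-0 a
    go (suc j) a u v (● ∷ c) = linear-scaled p (go j a _ _ c)

  G<-linear : ∀ {n} b j → Linear (G< {n} b j)
  G<-linear b j .cong u≋v c = G<-local b j c λ d _ → u≋v d
  G<-linear b zero    .linear a u v c = linear-0 a
  G<-linear b (suc j) .linear a u v c =
    linear-+ (G<-linear b j .linear a u v c) (G-linear b j .linear a u v c)

  T-linear : ∀ {n} i → Linear (T {n} i)
  T-linear i .cong u≋v c = T-local i c λ d _ → u≋v d
  T-linear i .linear = go i
    where
    go : ∀ {n} i a (u v : Fun n) → T i (a ⊙ u ⊕ v) ≋ a ⊙ T i u ⊕ T i v
    go i       a u v []      = linear-0 a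
    go i       a u v (○ ∷ c) = go i a _ _ c
    go zero    a u v (● ∷ c) = linear-+ (linear-scaled _ refl) (G-linear _ zero .linear a _ _ c)
    go (suc i) a u v (● ∷ c) = linear-+ (go i a _ _ c) (G-linear _ (suc i) .linear a _ _ c)

  H-linear : ∀ {n} k i → Linear (H {n} k i)
  H-linear k i .cong u≋v c = H-local k i c λ d _ → u≋v d
  H-linear k i .linear = go k i
    where
    go : ∀ {n} k i a (u v : Fun n) → H k i (a ⊙ u ⊕ v) ≋ a ⊙ H k i u ⊕ H k i v
    go k i       a u v []      = linear-0 a
    go k i       a u v (○ ∷ c) = go k i a _ _ c
    go k zero    a u v (● ∷ c) = linear-+ (linear-scaled _ refl) (G<-linear _ k .linear a _ _ c)
    go k (suc i) a u v (● ∷ c) = go (pred k) i a _ _ c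

  private
    G∘0 : ∀ {n} b j (c : Config n) → G b j 0ᶠ c ≈ 0#
    G∘0 b j c = zero-preserving (G-linear b j) c

  -- Seen from row 1 + j, removing row i turns a particle into a hole, so its weight
  -- exchanges a factor p for a factor q.
  G-G : ∀ {n} b b′ {i j} → i ℕ.≤ j → (v : Fun n) (c : Config n) →
        p * G b j (G b′ i v) c ≈ q * G b′ i (G b (suc j) v) c
  G-G b b′ i≤j v [] = trans (zeroʳ p) (sym (zeroʳ q))
  G-G {suc n} b b′ {zero} {zero} i≤j v (○ ∷ c) = begin
    -- The factor `0#` is `G b′ 0 v (● ∷ c)`: a particle removed from row 0 would have stood to the
    -- right of this last site.
    p * (q * G b 0 (λ d → q * G b′ 0 v○ d + g n b′ * v (● ∷ d)) c + g n b * 0#)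
      ≈⟨ *-congˡ (+-cong (*-congˡ expand) (zeroʳ _)) ⟩
    p * (q * (q * G b 0 (G b′ 0 v○) c + g n b′ * G b 0 v● c) + 0#)
      ≈⟨ solve 5 (λ p q x y z → p :* (q :* (q :* x :+ y :* z) :+ con 0)
                               := q :* (q :* (p :* x)) :+ p :* q :* (y :* z))
           refl p q _ _ _ ⟩
    q * (q * (p * G b 0 (G b′ 0 v○) c)) + p * q * (g n b′ * G b 0 v● c)
      ≈⟨ +-congʳ (*-congˡ (*-congˡ (G-G b b′ i≤j v○ c))) ⟩
    q * (q * (q * G b′ 0 (G b 1 v○) c)) + p * q * (g n b′ * G b 0 v● c)
      ≈⟨ solve 5 (λ p q x y z → q :* (q :* (q :* x)) :+ p :* q :* (y :* z)
                               := q :* (q :* (q :* x) :+ y :* (p :* z)))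
           refl p q _ _ _ ⟩
    q * (q * (q * G b′ 0 (G b 1 v○) c) + g n b′ * (p * G b 0 v● c))
      ≈⟨ *-congˡ (+-congʳ (*-congˡ (homogeneous (G-linear b′ 0) q _ c))) ⟨
    q * (q * G b′ 0 (q ⊙ G b 1 v○) c + g n b′ * (p * G b 0 v● c)) ∎
    where
    v○ = v ∘ (○ ∷_)
    v● = v ∘ (● ∷_)
    expand : G b 0 (q ⊙ G b′ 0 v○ ⊕ g n b′ ⊙ v●) c ≈ q * G b 0 (G b′ 0 v○) c + g n b′ * G b 0 v● c
    expand = trans (linear (G-linear b 0) q _ _ c) (+-congˡ (homogeneous (G-linear b 0) _ _ c))
  G-G {suc n} b b′ {zero} {suc j} i≤j v (○ ∷ c) = begin
    p * (q * G b (suc j) (λ d → q * G b′ 0 v○ d + g n b′ * v (● ∷ d)) c)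
      ≈⟨ *-congˡ (*-congˡ expand) ⟩
    p * (q * (q * G b (suc j) (G b′ 0 v○) c + g n b′ * G b (suc j) v● c))
      ≈⟨ solve 5 (λ p q x y z → p :* (q :* (q :* x :+ y :* z))
                               := q :* (q :* (p :* x)) :+ p :* q :* (y :* z))
           refl p q _ _ _ ⟩
    q * (q * (p * G b (suc j) (G b′ 0 v○) c)) + p * q * (g n b′ * G b (suc j) v● c)
      ≈⟨ +-congʳ (*-congˡ (*-congˡ (G-G b b′ i≤j v○ c))) ⟩
    q * (q * (q * G b′ 0 (G b (suc (suc j)) v○) c)) + p * q * (g n b′ * G b (suc j) v● c)
      ≈⟨ solve 5 (λ p q x y z → q :* (q :* (q :* x)) :+ p :* q :* (y :* z)
                               := q :* (q :* (q :* x) :+ y :* (p :* z)))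
           refl p q _ _ _ ⟩
    q * (q * (q * G b′ 0 (G b (suc (suc j)) v○) c) + g n b′ * (p * G b (suc j) v● c))
      ≈⟨ *-congˡ (+-congʳ (*-congˡ (homogeneous (G-linear b′ 0) q _ c))) ⟨
    q * (q * G b′ 0 (q ⊙ G b (suc (suc j)) v○) c + g n b′ * (p * G b (suc j) v● c)) ∎
    where
    v○ = v ∘ (○ ∷_)
    v● = v ∘ (● ∷_)
    expand : G b (suc j) (q ⊙ G b′ 0 v○ ⊕ g n b′ ⊙ v●) c
             ≈ q * G b (suc j) (G b′ 0 v○) c + g n b′ * G b (suc j) v● c
    expand = trans (linear (G-linear b (suc j)) q _ _ c)
                   (+-congˡ (homogeneous (G-linear b (suc j)) _ _ c))
  G-G b b′ {suc i} {suc j} i≤j v (○ ∷ c) = begin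
    p * (q * G b (suc j) (q ⊙ G b′ (suc i) v○) c)
      ≈⟨ *-congˡ (*-congˡ (homogeneous (G-linear b (suc j)) q _ c)) ⟩
    p * (q * (q * G b (suc j) (G b′ (suc i) v○) c))
      ≈⟨ solve 3 (λ p q x → p :* (q :* (q :* x)) := q :* (q :* (p :* x))) refl p q _ ⟩
    q * (q * (p * G b (suc j) (G b′ (suc i) v○) c))
      ≈⟨ *-congˡ (*-congˡ (G-G b b′ i≤j v○ c)) ⟩
    q * (q * (q * G b′ (suc i) (G b (suc (suc j)) v○) c))
      ≈⟨ *-congˡ (*-congˡ (homogeneous (G-linear b′ (suc i)) q _ c)) ⟨
    q * (q * G b′ (suc i) (q ⊙ G b (suc (suc j)) v○) c) ∎
    where v○ = v ∘ (○ ∷_)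
  G-G b b′ {zero} {zero}  i≤j v (● ∷ c) = trans (zeroʳ p) (sym (zeroʳ q))
  G-G b b′ {zero} {suc j} i≤j v (● ∷ c) = begin
    p * (p * G b j 0ᶠ c)  ≈⟨ *-congˡ (trans (*-congˡ (G∘0 b j c)) (zeroʳ p)) ⟩
    p * 0#                ≈⟨ zeroʳ p ⟩
    0#                    ≈⟨ zeroʳ q ⟨
    q * 0#                ∎
  G-G b b′ {suc i} {suc j} (s≤s i≤j) v (● ∷ c) = begin
    p * (p * G b j (p ⊙ G b′ i v●) c)
      ≈⟨ *-congˡ (*-congˡ (homogeneous (G-linear b j) p _ c)) ⟩
    p * (p * (p * G b j (G b′ i v●) c))
      ≈⟨ *-congˡ (*-congˡ (G-G b b′ i≤j v● c)) ⟩
    p * (p * (q * G b′ i (G b (suc j) v●) c))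
      ≈⟨ solve 3 (λ p q x → p :* (p :* (q :* x)) := q :* (p :* (p :* x))) refl p q _ ⟩
    q * (p * (p * G b′ i (G b (suc j) v●) c))
      ≈⟨ *-congˡ (*-congˡ (homogeneous (G-linear b′ i) p _ c)) ⟨
    q * (p * G b′ i (p ⊙ G b (suc j) v●) c) ∎
    where v● = v ∘ (● ∷_)

  -- A jump from row `i ≤ j` exchanges a particle and a hole, both to the right of row `suc j`. That
  -- row keeps its number and passes as many particles and as many holes as before. At the landing
  -- site the factors `p` and `q` are traded by `G-G`.
  G-T : ∀ {n} b {i j} → i ℕ.≤ j → (v : Fun n) → G b (suc j) (T i v) ≋ T i (G b (suc j) v)
  G-T b i≤j v []      = refl
  G-T b {i} {j} i≤j v (○ ∷ c) = begin
    q * G b (suc j) (T i (v ∘ (○ ∷_))) c  ≈⟨ *-congˡ (G-T b i≤j _ c) ⟩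
    q * T i (G b (suc j) (v ∘ (○ ∷_))) c  ≈⟨ homogeneous (T-linear i) q _ c ⟨
    T i (q ⊙ G b (suc j) (v ∘ (○ ∷_))) c  ∎
  G-T {suc n} b {zero} {j} i≤j v (● ∷ c) = begin
    p * G b j (τ n ⊙ v● ⊕ G n 0 v○) c
      ≈⟨ *-congˡ (linear (G-linear b j) (τ n) _ _ c) ⟩
    p * (τ n * G b j v● c + G b j (G n 0 v○) c)
      ≈⟨ solve 4 (λ p s x y → p :* (s :* x :+ y) := s :* (p :* x) :+ p :* y) refl p _ _ _ ⟩
    τ n * (p * G b j v● c) + p * G b j (G n 0 v○) c
      ≈⟨ +-congˡ (G-G b n i≤j v○ c) ⟩
    τ n * (p * G b j v● c) + q * G n 0 (G b (suc j) v○) c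
      ≈⟨ +-congˡ (homogeneous (G-linear n 0) q _ c) ⟨
    τ n * (p * G b j v● c) + G n 0 (q ⊙ G b (suc j) v○) c ∎
    where
    v○ = v ∘ (○ ∷_)
    v● = v ∘ (● ∷_)
  G-T {suc n} b {suc i} {suc j} (s≤s i≤j) v (● ∷ c) = begin
    p * G b (suc j) (T i v● ⊕ G n (suc i) v○) c
      ≈⟨ *-congˡ (additive (G-linear b (suc j)) _ _ c) ⟩
    p * (G b (suc j) (T i v●) c + G b (suc j) (G n (suc i) v○) c)
      ≈⟨ distribˡ p _ _ ⟩
    p * G b (suc j) (T i v●) c + p * G b (suc j) (G n (suc i) v○) c
      ≈⟨ +-cong (*-congˡ (G-T b i≤j v● c)) (G-G b n (s≤s i≤j) v○ c) ⟩
    p * T i (G b (suc j) v●) c + q * G n (suc i) (G b (suc (suc j)) v○) c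
      ≈⟨ +-cong (homogeneous (T-linear i) p _ c) (homogeneous (G-linear n (suc i)) q _ c) ⟨
    T i (p ⊙ G b (suc j) v●) c + G n (suc i) (q ⊙ G b (suc (suc j)) v○) c ∎
    where
    v○ = v ∘ (○ ∷_)
    v● = v ∘ (● ∷_)

  -- All factors have indices below `k ≤ j`, so `G-T` applies to each of them in turn.
  G-e₂T : ∀ {n} b {k j} → k ℕ.≤ j → ∀ r (v : Fun n) → G b j (e₂ T k r v) ≋ e₂ T k r (G b j v)
  G-e₂T b         k≤j zero    v c = refl
  G-e₂T b {zero}  k≤j (suc r) v c = G∘0 b _ c
  G-e₂T b {suc k} {suc j} (s≤s k≤j) (suc r) v c = begin
    G b (suc j) (e₂ T k (suc r) v ⊕ T k (e₂ T k r v)) c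
      ≈⟨ additive (G-linear b (suc j)) _ _ c ⟩
    G b (suc j) (e₂ T k (suc r) v) c + G b (suc j) (T k (e₂ T k r v)) c
      ≈⟨ +-cong (G-e₂T b (ℕ.m≤n⇒m≤1+n k≤j) (suc r) v c)
           (trans (G-T b k≤j _ c) (T-linear k .cong (G-e₂T b (ℕ.m≤n⇒m≤1+n k≤j) r v) c)) ⟩
    e₂ T k (suc r) (G b (suc j) v) c + T k (e₂ T k r (G b (suc j) v)) c ∎

  -- Particles only move to the right, so a last site that is empty at the end was empty throughout.
  e₂T-○ : ∀ {n} k r (v : Fun (suc n)) c → e₂ T k r v (○ ∷ c) ≈ e₂ T k r (v ∘ (○ ∷_)) c
  e₂T-○ k       zero    v c = refl
  e₂T-○ zero    (suc r) v c = refl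
  e₂T-○ (suc k) (suc r) v c =
    +-cong (e₂T-○ k (suc r) v c) (T-linear k .cong (λ d → e₂T-○ k r v d) c)

  -- The particle that ends up on the last site may be assumed to jump there first.
  e₂T-● : ∀ {n} k r (v : Fun (suc n)) c → e₂ T (suc k) (suc r) v (● ∷ c) ≈
          e₂ T k (suc r) (v ∘ (● ∷_)) c
          + e₂ T k r (τ n ⊙ v ∘ (● ∷_) ⊕ G< n (suc k) (v ∘ (○ ∷_))) c
  e₂T-● zero zero    v c = +-congˡ (+-congˡ (sym (+-identityˡ _)))
  e₂T-● {n} zero (suc r) v c = +-congˡ (trans (+-cong (zeroʳ _) (G∘0 n 0 c)) (+-identityˡ 0#))
  e₂T-● {n} (suc k) r v c = begin
    e₂ T (suc k) (suc r) v (● ∷ c)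
      + (T k (λ d → e₂ T (suc k) r v (● ∷ d)) c + G n (suc k) (λ d → e₂ T (suc k) r v (○ ∷ d)) c)
      ≈⟨ +-cong (e₂T-● k r v c) (+-congˡ last) ⟩
    (e₂ T k (suc r) v● c + e₂ T k r w c)
      + (T k (λ d → e₂ T (suc k) r v (● ∷ d)) c + e₂ T (suc k) r (G n (suc k) v○) c)
      ≈⟨ regroup r ⟩
    e₂ T (suc k) (suc r) v● c + (e₂ T (suc k) r w c + e₂ T (suc k) r (G n (suc k) v○) c)
      ≈⟨ +-congˡ (additive (e₂-linear T-linear (suc k) r) _ _ c) ⟨
    e₂ T (suc k) (suc r) v● c + e₂ T (suc k) r (w ⊕ G n (suc k) v○) c
      ≈⟨ +-congˡ (e₂-linear T-linear (suc k) r .cong (λ d → +-assoc _ _ _) c) ⟩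
    e₂ T (suc k) (suc r) v● c + e₂ T (suc k) r (τ n ⊙ v● ⊕ G< n (suc (suc k)) v○) c ∎
    where
    v○ = v ∘ (○ ∷_)
    v● = v ∘ (● ∷_)
    w = τ n ⊙ v● ⊕ G< n (suc k) v○
    -- Here the last site is filled by the final factor. All earlier factors act on rows to the
    -- right of the jumping one, so its jump can be brought to the front.
    last : G n (suc k) (λ d → e₂ T (suc k) r v (○ ∷ d)) c ≈ e₂ T (suc k) r (G n (suc k) v○) c
    last = trans (G-linear n (suc k) .cong (e₂T-○ (suc k) r v) c) (G-e₂T n ℕ.≤-refl r v○ c)
    -- The induction hypothesis concerns a positive number of factors; for `r = 0` the function
    -- under `T k` is `v` itself.
    regroup : ∀ r {z} → (e₂ T k (suc r) v● c + e₂ T k r w c)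
                          + (T k (λ d → e₂ T (suc k) r v (● ∷ d)) c + z)
                        ≈ e₂ T (suc k) (suc r) v● c + (e₂ T (suc k) r w c + z)
    regroup zero    = solve 4 (λ x y z u → (x :+ y) :+ (z :+ u) := (x :+ z) :+ (y :+ u)) refl _ _ _ _
    regroup (suc r) = trans
      (+-congˡ (+-congʳ (trans (T-linear k .cong (e₂T-● k r v) c) (additive (T-linear k) _ _ c))))
      (solve 5 (λ x y z s u → (x :+ y) :+ ((z :+ s) :+ u) := (x :+ z) :+ ((y :+ s) :+ u))
         refl _ _ _ _ _)

  -- For `H` the last site involves only the factor of row 0, which acts first and is isolated by
  -- `e₁`. For `T` the induction peels off the final factor, hence the passage to `e₂`.
  e₁T≋e₁H : ∀ {n} k r (v : Fun n) → e₁ T k r v ≋ e₁ (H k) k r v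
  e₁T≋e₁H k r v c = trans (e₁≋e₂ T-linear k r v c) (sym (go c k r v))
    where
    go : ∀ {n} (c : Config n) k r v → e₁ (H k) k r v c ≈ e₂ T k r v c
    go c       k       zero    v = refl
    go []      k       (suc r) v = trans (e₁-[] (λ _ _ → refl) k r v) (sym (e₂-[] k r v))
      where
      e₁-[] : {F : ℕ → Op 0} → (∀ i v → F i v [] ≈ 0#) → ∀ k r v → e₁ F k (suc r) v [] ≈ 0#
      e₁-[] F≈0 zero    r       v = refl
      e₁-[] F≈0 (suc k) zero    v =
        trans (+-cong (F≈0 0 v) (e₁-[] (F≈0 ∘ suc) k 0 v)) (+-identityˡ 0#)
      e₁-[] F≈0 (suc k) (suc r) v =
        trans (+-cong (e₁-[] (F≈0 ∘ suc) k r _) (e₁-[] (F≈0 ∘ suc) k (suc r) v)) (+-identityˡ 0#)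
      e₂-[] : ∀ k r v → e₂ T k (suc r) v [] ≈ 0#
      e₂-[] zero    r v = refl
      e₂-[] (suc k) r v = trans (+-identityʳ _) (e₂-[] k r v)
    go (○ ∷ c) k       r       v = begin
      e₁ (H k) k r v (○ ∷ c)       ≈⟨ e₁-∘ (H-linear k) (○ ∷_) (λ _ _ _ → refl) k r v c ⟩
      e₁ (H k) k r (v ∘ (○ ∷_)) c  ≈⟨ go c k r _ ⟩
      e₂ T k r (v ∘ (○ ∷_)) c      ≈⟨ e₂T-○ k r v c ⟨
      e₂ T k r v (○ ∷ c)           ∎
    go (● ∷ c) zero    (suc r) v = refl
    go (● ∷ c) (suc k) (suc r) v = begin
      e₁ (H (suc k) ∘ suc) k r (H (suc k) 0 v) (● ∷ c) + e₁ (H (suc k) ∘ suc) k (suc r) v (● ∷ c)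
        ≈⟨ +-cong (shift r _) (shift (suc r) v) ⟩
      e₁ (H k) k r w c + e₁ (H k) k (suc r) (v ∘ (● ∷_)) c
        ≈⟨ +-cong (go c k r w) (go c k (suc r) _) ⟩
      e₂ T k r w c + e₂ T k (suc r) (v ∘ (● ∷_)) c
        ≈⟨ +-comm _ _ ⟩
      e₂ T k (suc r) (v ∘ (● ∷_)) c + e₂ T k r w c
        ≈⟨ e₂T-● k r v c ⟨
      e₂ T (suc k) (suc r) v (● ∷ c) ∎
      where
      -- By definition this is `τ n ⊙ v ∘ (● ∷_) ⊕ G< n (suc k) (v ∘ (○
      -- ∷_))`, the function that occurs in `e₂T-●`.
      w = H (suc k) 0 v ∘ (● ∷_)
      shift : ∀ r v → e₁ (H (suc k) ∘ suc) k r v (● ∷ c) ≈ e₁ (H k) k r (v ∘ (● ∷_)) c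
      shift r v = e₁-∘ (H-linear k) (● ∷_) (λ _ _ _ → refl) k r v c

-- Configurations encoded by descending sequences.

infixr 5 _∷_

data Descending : ∀ {k} → ℕ → Vec ℕ k → Set where
  []  : ∀ {m} → Descending m []
  _∷_ : ∀ {m k x} {X : Vec ℕ k} → x ℕ.≤ m → Descending x X → Descending m (x ∷ X)

descending-≤ : ∀ {m m′ k} {X : Vec ℕ k} → m ℕ.≤ m′ → Descending m X → Descending m′ X
descending-≤ m≤m′ []        = []
descending-≤ m≤m′ (x≤m ∷ D) = ℕ.≤-trans x≤m m≤m′ ∷ D

lookup≤ : ∀ {m k} {X : Vec ℕ k} → Descending m X → ∀ i → lookup X i ℕ.≤ m
lookup≤ (x≤m ∷ D) zero    = x≤m
lookup≤ (x≤m ∷ D) (suc i) = ℕ.≤-trans (lookup≤ D i) x≤m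

-- Code c m X: reading c from the right, its particles have X₀, X₁, … holes to their
-- left, and there are m holes in all.
data Code : ∀ {n k} → Config n → ℕ → Vec ℕ k → Set where
  []  : Code [] 0 []
  ○∷_ : ∀ {n k m} {c : Config n} {X : Vec ℕ k} → Code c m X → Code (○ ∷ c) (suc m) X
  ●∷_ : ∀ {n k m} {c : Config n} {X : Vec ℕ k} → Code c m X → Code (● ∷ c) m (m ∷ X)

code-descending : ∀ {n k m} {c : Config n} {X : Vec ℕ k} → Code c m X → Descending m X
code-descending []     = []
code-descending (○∷ C) = descending-≤ (ℕ.n≤1+n _) (code-descending C)
code-descending (●∷ C) = ℕ.≤-refl ∷ code-descending C

code-size : ∀ {n k m} {c : Config n} {X : Vec ℕ k} → Code c m X → n ≡ m ℕ.+ k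
code-size []             = ≡.refl
code-size (○∷ C)         = ≡.cong suc (code-size C)
code-size {m = m} (●∷ C) = ≡.trans (≡.cong suc (code-size C)) (≡.sym (ℕ.+-suc m _))

code-particles : ∀ {n k m} {c : Config n} {X : Vec ℕ k} → Code c m X → particles c ≡ k
code-particles []     = ≡.refl
code-particles (○∷ C) = code-particles C
code-particles (●∷ C) = ≡.cong suc (code-particles C)

code-functional : ∀ {n k m} {c : Config n} {X Y : Vec ℕ k} → Code c m X → Code c m Y → X ≡ Y
code-functional []     []      = ≡.refl
code-functional (○∷ C) (○∷ C′) = code-functional C C′
code-functional (●∷ C) (●∷ C′) = ≡.cong (_ ∷_) (code-functional C C′)

code-injective : ∀ {n k m} {c d : Config n} {X : Vec ℕ k} → Code c m X → Code d m X → c ≡ d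
code-injective []     []      = ≡.refl
code-injective (○∷ C) (○∷ C′) = ≡.cong (○ ∷_) (code-injective C C′)
code-injective (●∷ C) (●∷ C′) = ≡.cong (● ∷_) (code-injective C C′)
-- A particle on the last site has all the holes to its left; if the last site is a hole, every
-- particle has at least one hole fewer. The same clash excludes many cases below.
code-injective (○∷ C) (●∷ C′) with code-descending C
... | m<m ∷ _ = contradiction m<m (ℕ.<-irrefl ≡.refl)
code-injective (●∷ C) (○∷ C′) with code-descending C′
... | m<m ∷ _ = contradiction m<m (ℕ.<-irrefl ≡.refl)

-- The last site carries a particle exactly when the first entry equals the number of holes.
encode : ∀ n m {k} {X : Vec ℕ k} → n ≡ m ℕ.+ k → Descending m X → ∃ λ (c : Config n) → Code c m X
encode zero    zero    eq [] = [] , []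
encode (suc n) (suc m) eq [] with encode n m (ℕ.suc-injective eq) []
... | c , C = ○ ∷ c , ○∷ C
encode zero    (suc m) () (_ ∷ _)
encode zero    zero    () (_ ∷ _)
encode (suc n) m {suc k} eq (_∷_ {x = x} x≤m D) with x ℕ.≟ m
... | yes ≡.refl with encode n m (ℕ.suc-injective (≡.trans eq (ℕ.+-suc m k))) D
...   | c , C = ● ∷ c , ●∷ C
encode (suc n) zero    eq (z≤n ∷ D) | no x≢m = contradiction ≡.refl x≢m
encode (suc n) (suc m) eq (x≤m ∷ D) | no x≢m
  with encode n m (ℕ.suc-injective eq) (ℕ.s≤s⁻¹ (ℕ.≤∧≢⇒< x≤m x≢m) ∷ D)
... | c , C = ○ ∷ c , ○∷ C

decode : ∀ {n} (c : Config n) → ∃ λ m → ∃ λ (X : Vec ℕ (particles c)) → Code c m X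
decode []      = 0 , [] , []
decode (○ ∷ c) with m , X , C ← decode c = suc m , X , ○∷ C
decode (● ∷ c) with m , X , C ← decode c = m , m ∷ X , ●∷ C

-- Removing and moving a particle in terms of codes.

-- The vacated site is a new hole to the left of the rows before `j`, whose entries grow by one; the
-- rows after `j` keep theirs.
data Take : ∀ {k} → Fin (suc k) → Vec ℕ (suc k) → Vec ℕ k → Set where
  here  : ∀ {k x} {X : Vec ℕ k} → Take zero (x ∷ X) X
  there : ∀ {k j x} {X : Vec ℕ (suc k)} {Y : Vec ℕ k} → Take j X Y → Take (suc j) (x ∷ X) (suc x ∷ Y)

-- Move i j X Y: the configuration Y is X with the particle of row j moved to the right,
-- where it becomes row i.
data Move : ∀ {k} → Fin k → Fin k → Vec ℕ k → Vec ℕ k → Set where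
  -- For `j = 0` the condition `x < y` says that the particle advances; for `j > 0` the first entry
  -- of `Y` is `suc x`, and the condition says that the particle lands to the right of that row.
  jump : ∀ {k j x y} {X Y : Vec ℕ k} → x ℕ.< y → Take j (x ∷ X) Y → Move zero j (x ∷ X) (y ∷ Y)
  skip : ∀ {k i j x} {X Y : Vec ℕ k} → Move i j X Y → Move (suc i) (suc j) (x ∷ X) (x ∷ Y)

move-≢ : ∀ {k i j} {X Y : Vec ℕ k} → Move i j X Y → X ≢ Y
move-≢ (jump x<x _) ≡.refl = ℕ.<-irrefl ≡.refl x<x
move-≢ (skip J)     ≡.refl = move-≢ J ≡.refl

-- The number of a site is the number of holes plus the number of particles to its left.
position : ∀ {k} → Vec ℕ k → Fin k → ℕ
position {suc k} (x ∷ X) zero    = x ℕ.+ k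
position         (x ∷ X) (suc i) = position X i

position≡ : ∀ {k} (X : Vec ℕ k) i → position X i ≡ lookup X i ℕ.+ toℕ (Fin.opposite i)
position≡ {suc k} (x ∷ X) zero    = ≡.cong (x ℕ.+_) (≡.sym (Fin.toℕ-fromℕ k))
position≡ (x ∷ X) (suc i) = ≡.trans (position≡ X i)
  (≡.cong (lookup X i ℕ.+_) (≡.sym (Fin.toℕ-inject₁ (Fin.opposite i))))

suc∸∸1 : ∀ m n → suc m ∸ n ∸ 1 ≡ m ∸ n
suc∸∸1 m n = ≡.trans (ℕ.∸-+-assoc (suc m) n 1) (≡.cong (suc m ∸_) (ℕ.+-comm n 1))

if-≡ᵇ-refl : ∀ {a} {A : Set a} n {x y : A} → (if n ≡ᵇ n then x else y) ≡ x
if-≡ᵇ-refl zero    = ≡.refl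
if-≡ᵇ-refl (suc n) = if-≡ᵇ-refl n

if-≡ᵇ-≢ : ∀ {a} {A : Set a} {m n} {x y : A} → m ≢ n → (if m ≡ᵇ n then x else y) ≡ y
if-≡ᵇ-≢ {m = zero}  {zero}  m≢n = contradiction ≡.refl m≢n
if-≡ᵇ-≢ {m = zero}  {suc n} m≢n = ≡.refl
if-≡ᵇ-≢ {m = suc m} {zero}  m≢n = ≡.refl
if-≡ᵇ-≢ {m = suc m} {suc n} m≢n = if-≡ᵇ-≢ (m≢n ∘ ≡.cong suc)

-- Matrix entries of the jump operators.

module Kernels {c ℓ} (R : CommutativeRing c ℓ) (p q : CommutativeRing.Carrier R)
  (τ : ℕ → CommutativeRing.Carrier R) (g : ℕ → ℕ → CommutativeRing.Carrier R) where

  open CommutativeRing R hiding (zero)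
  open RingSolver commutativeSemiring using (solve; _:=_; _:+_; _:*_)
  open SetoidReasoning setoid
  open Exp semiring using (_^_; ^-congʳ)
  open Functions R
  open Linear
  open Jumps R p q τ g

  δ : ∀ {n} → Config n → Fun n
  δ []      []      = 1#
  δ (○ ∷ c) (○ ∷ d) = δ c d
  δ (○ ∷ c) (● ∷ d) = 0#
  δ (● ∷ c) (○ ∷ d) = 0#
  δ (● ∷ c) (● ∷ d) = δ c d

  δ-refl : ∀ {n} (c : Config n) → δ c c ≡ 1#
  δ-refl []      = ≡.refl
  δ-refl (○ ∷ c) = δ-refl c
  δ-refl (● ∷ c) = δ-refl c

  δ-≢ : ∀ {n} {c d : Config n} → c ≢ d → δ c d ≡ 0#
  δ-≢ {c = []}    {[]}    c≢d = contradiction ≡.refl c≢d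
  δ-≢ {c = ○ ∷ c} {○ ∷ d} c≢d = δ-≢ (c≢d ∘ ≡.cong (○ ∷_))
  δ-≢ {c = ○ ∷ c} {● ∷ d} c≢d = ≡.refl
  δ-≢ {c = ● ∷ c} {○ ∷ d} c≢d = ≡.refl
  δ-≢ {c = ● ∷ c} {● ∷ d} c≢d = δ-≢ (c≢d ∘ ≡.cong (● ∷_))

  private
    δ-same : ∀ {n k m} {c d : Config n} {X : Vec ℕ k} → Code c m X → Code d m X → δ c d ≈ 1#
    δ-same {c = c} C D with ≡.refl ← code-injective C D = reflexive (δ-refl c)

    δ-distinct : ∀ {n k m} {c d : Config n} {X Y : Vec ℕ k} → Code c m X → Code d m Y → X ≢ Y → δ c d ≈ 0#
    δ-distinct {c = c} {d} C D X≢Y = reflexive (δ-≢ c≢d)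
      where
      c≢d : c ≢ d
      c≢d ≡.refl = X≢Y (code-functional C D)

    *-if : ∀ s b {x y} → s * x ≈ y → s * (if b then x else 0#) ≈ (if b then y else 0#)
    *-if s true  sx≈y = sx≈y
    *-if s false sx≈y = zeroʳ s

    if-cong : ∀ b {x y} → x ≈ y → (if b then x else 0#) ≈ (if b then y else 0#)
    if-cong true  x≈y = x≈y
    if-cong false x≈y = refl

    module _ {n k m} {c : Config n} {X : Vec ℕ k} (C : Code c m X) where

      G∘0 : ∀ b j → G b j 0ᶠ c ≈ 0#
      G∘0 b j = zero-preserving (G-linear b j) c

      G<∘0 : ∀ b j → G< b j 0ᶠ c ≈ 0#
      G<∘0 b j = zero-preserving (G<-linear b j) c

      T∘0 : ∀ i → T i 0ᶠ c ≈ 0#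
      T∘0 i = zero-preserving (T-linear i) c

      H∘0 : ∀ k i → H k i 0ᶠ c ≈ 0#
      H∘0 k i = zero-preserving (H-linear k i) c

    q^-suc : ∀ a {m x} → x ℕ.≤ m → q * (a * q ^ (m ∸ x)) ≈ a * q ^ (suc m ∸ x)
    q^-suc a {m} {x} x≤m = begin
      q * (a * q ^ (m ∸ x))    ≈⟨ solve 3 (λ q a b → q :* (a :* b) := a :* (q :* b)) refl q a _ ⟩
      a * q ^ (suc (m ∸ x))    ≈⟨ *-congˡ (^-congʳ q (≡.sym (ℕ.+-∸-assoc 1 x≤m))) ⟩
      a * q ^ (suc m ∸ x)      ∎

  -- A jump beyond the end passes everything to the right of row `j`: `toℕ j` particles, and those
  -- of the `m` holes that are not among the `lookup X j` on its left.
  G-take : ∀ {n m k j} {c d : Config n} {X : Vec ℕ (suc k)} {Y : Vec ℕ k} →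
           Code c m X → Code d (suc m) Y → Take j X Y → ∀ b r →
           G b r (δ c) d ≈
           (if r ≡ᵇ toℕ j then g (position X j) b * p ^ toℕ j * q ^ (m ∸ lookup X j) else 0#)
  G-take {j = j} (○∷ C) (○∷ D) J b zero = trans
    (+-cong (trans (*-congˡ (G-take C D J b 0))
                   (*-if q (0 ≡ᵇ toℕ j) (q^-suc _ (lookup≤ (code-descending C) j))))
            (zeroʳ _))
    (+-identityʳ _)
  G-take {j = j} (○∷ C) (○∷ D) J b (suc r) = trans (*-congˡ (G-take C D J b (suc r)))
    (*-if q (suc r ≡ᵇ toℕ j) (q^-suc _ (lookup≤ (code-descending C) j)))
  -- A last site that is empty before the removal cannot be occupied after it.
  G-take (○∷ C) (●∷ D) J b r = contradiction J (absurd (code-descending C))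
    where
    absurd : ∀ {m k j} {X : Vec ℕ (2 ℕ.+ k)} {Y : Vec ℕ k} → Descending m X → ¬ Take j X (2 ℕ.+ m ∷ Y)
    absurd (x≤m ∷ y≤x ∷ _) here      = ℕ.<⇒≱ (ℕ.m<n⇒m<1+n (ℕ.n<1+n _)) (ℕ.≤-trans y≤x x≤m)
    absurd (x≤m ∷ _)       (there J) = ℕ.<-irrefl ≡.refl x≤m
  G-take {m = m} (●∷ C) (○∷ D) here b zero = begin
    _                ≈⟨ +-cong (trans (*-congˡ (G∘0 D b 0)) (zeroʳ q)) (*-congˡ (δ-same C D)) ⟩
    0# + g _ b * 1#  ≈⟨ +-identityˡ _ ⟩
    g _ b * 1#       ≈⟨ *-identityʳ _ ⟨
    g _ b * 1# * 1#  ≈⟨ *-cong (*-congʳ (reflexive (≡.cong (λ a → g a b) (code-size C))))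
                               (^-congʳ q (≡.sym (ℕ.n∸n≡0 m))) ⟩
    _                ∎
  G-take (●∷ C) (○∷ D) here b (suc r) = trans (*-congˡ (G∘0 D b (suc r))) (zeroʳ q)
  G-take (●∷ C) (○∷ D) (there J) b r with code-descending D
  ... | m<m ∷ _ = contradiction m<m (ℕ.<-irrefl ≡.refl)
  G-take (●∷ C) (●∷ D) here b r with code-descending C
  ... | m<m ∷ _ = contradiction m<m (ℕ.<-irrefl ≡.refl)
  G-take (●∷ C) (●∷ D) (there J) b zero    = refl
  G-take (●∷ C) (●∷ D) (there J) b (suc r) = trans (*-congˡ (G-take C D J b r))
    (*-if p (r ≡ᵇ _) (solve 4 (λ p a b d → p :* (a :* b :* d) := a :* (p :* b) :* d) refl p _ _ _))

  G-¬take : ∀ {n m k} {c d : Config n} {X : Vec ℕ (suc k)} {Y : Vec ℕ k} →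
            Code c m X → Code d (suc m) Y → (∀ j → ¬ Take j X Y) → ∀ b r → G b r (δ c) d ≈ 0#
  G-¬take (○∷ C) (○∷ D) ¬J b zero    =
    trans (+-cong (trans (*-congˡ (G-¬take C D ¬J b 0)) (zeroʳ q)) (zeroʳ _)) (+-identityˡ 0#)
  G-¬take (○∷ C) (○∷ D) ¬J b (suc r) = trans (*-congˡ (G-¬take C D ¬J b (suc r))) (zeroʳ q)
  G-¬take (○∷ C) (●∷ D) ¬J b zero    = refl
  G-¬take (○∷ C) (●∷ D) ¬J b (suc r) = trans (*-congˡ (G∘0 D b r)) (zeroʳ p)
  G-¬take (●∷ C) (○∷ D) ¬J b zero    = trans
    (+-cong (trans (*-congˡ (G∘0 D b 0)) (zeroʳ q))
            (trans (*-congˡ (δ-distinct C D λ { ≡.refl → ¬J zero here })) (zeroʳ _)))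
    (+-identityˡ 0#)
  G-¬take (●∷ C) (○∷ D) ¬J b (suc r) = trans (*-congˡ (G∘0 D b (suc r))) (zeroʳ q)
  G-¬take (●∷ C) (●∷ D) ¬J b zero    = refl
  G-¬take {k = suc k} (●∷ C) (●∷ D) ¬J b (suc r) =
    trans (*-congˡ (G-¬take C D (λ j J → ¬J (suc j) (there J)) b r)) (zeroʳ p)

  G<-if : ∀ {n} b k j {v : Fun n} {c w} → (∀ r → G b r v c ≈ (if r ≡ᵇ j then w else 0#)) →
          (j ℕ.< k → G< b k v c ≈ w) × (k ℕ.≤ j → G< b k v c ≈ 0#)
  G<-if b zero    j G≈ = (λ ()) , λ _ → refl
  G<-if b (suc k) j {v} {c} {w} G≈ with G<-if b k j G≈ | k ℕ.≟ j
  ... | _  , ≥ | yes ≡.refl =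
    (λ _ → trans (+-cong (≥ ℕ.≤-refl) (trans (G≈ k) (reflexive (if-≡ᵇ-refl k)))) (+-identityˡ w)) ,
    λ k<k → contradiction k<k (ℕ.<-irrefl ≡.refl)
  ... | lt , ≥ | no k≢j =
    (λ j≤k → trans (+-cong (lt (ℕ.≤∧≢⇒< (ℕ.s≤s⁻¹ j≤k) (k≢j ∘ ≡.sym))) Gk≈0) (+-identityʳ w)) ,
    λ k<j → trans (+-cong (≥ (ℕ.<⇒≤ k<j)) Gk≈0) (+-identityʳ 0#)
    where
    Gk≈0 : G b k v c ≈ 0#
    Gk≈0 = trans (G≈ k) (reflexive (if-≡ᵇ-≢ k≢j))

  G<-zero : ∀ {n} b k {v : Fun n} {c} → (∀ r → G b r v c ≈ 0#) → G< b k v c ≈ 0#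
  G<-zero b zero    G≈0 = refl
  G<-zero b (suc k) G≈0 = trans (+-cong (G<-zero b k G≈0) (G≈0 k)) (+-identityˡ 0#)

  -- The difference `lookup Y i ∸ lookup X j` counts the holes strictly between start and landing
  -- site together with the vacated site, which is not passed; hence the `∸ 1`.
  jumpWeight : ∀ {k} → Vec ℕ k → Vec ℕ k → Fin k → Fin k → Carrier
  jumpWeight X Y i j =
    g (position X j) (position Y i) * p ^ (toℕ j ∸ toℕ i) * q ^ (lookup Y i ∸ lookup X j ∸ 1)

  G-jump : ∀ {n m k j} {c d : Config n} {X : Vec ℕ (suc k)} {Y : Vec ℕ k} →
           Code c m X → Code d (suc m) Y → Take j X Y → ∀ r →
           G n r (δ c) d ≈ (if r ≡ᵇ toℕ j then jumpWeight X (suc m ∷ Y) zero j else 0#)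
  G-jump {m = m} {j = j} {X = X} C D J r = trans (G-take C D J _ r) (if-cong (r ≡ᵇ toℕ j)
    (*-cong (*-congʳ (reflexive (≡.cong (g _) (code-size D)))) (^-congʳ q (≡.sym (suc∸∸1 m (lookup X j))))))

  -- Sites are stripped from the right until the landing site is last; there `G-jump` gives the
  -- weight and singles out the row before the move.
  T-move : ∀ {n m k i j} {c d : Config n} {X Y : Vec ℕ k} → Code c m X → Code d m Y → Move i j X Y →
           ∀ r → T r (δ c) d ≈ (if r ≡ᵇ toℕ j then jumpWeight X Y i j else 0#)
  T-move (○∷ C) (○∷ D) J r = T-move C D J r
  T-move (○∷ C) (●∷ D) (jump _ J) zero =
    trans (+-congʳ (zeroʳ _)) (trans (+-identityˡ _) (G-jump C D J 0))
  T-move (○∷ C) (●∷ D) (jump _ J) (suc r) =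
    trans (+-congʳ (T∘0 D r)) (trans (+-identityˡ _) (G-jump C D J (suc r)))
  T-move (○∷ C) (●∷ D) (skip J) r with code-descending C
  ... | m<m ∷ _ = contradiction m<m (ℕ.<-irrefl ≡.refl)
  T-move (●∷ C) (○∷ D) (jump x<y J) r with code-descending D
  ... | y≤m ∷ _ = contradiction (ℕ.<-≤-trans x<y y≤m) (ℕ.<⇒≯ (ℕ.n<1+n _))
  T-move (●∷ C) (○∷ D) (skip J) r with code-descending D
  ... | m<m ∷ _ = contradiction m<m (ℕ.<-irrefl ≡.refl)
  T-move (●∷ C) (●∷ D) (jump x<x J) r = contradiction x<x (ℕ.<-irrefl ≡.refl)
  T-move (●∷ C) (●∷ D) (skip J) zero = trans
    (+-cong (trans (*-congˡ (δ-distinct C D (move-≢ J))) (zeroʳ _)) (G∘0 D _ 0)) (+-identityˡ 0#)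
  T-move (●∷ C) (●∷ D) (skip J) (suc r) =
    trans (+-cong (T-move C D J r) (G∘0 D _ (suc r))) (+-identityʳ _)

  H-move : ∀ {n m k i j} {c d : Config n} {X Y : Vec ℕ k} → Code c m X → Code d m Y → Move i j X Y →
           ∀ r → H k r (δ c) d ≈ (if r ≡ᵇ toℕ i then jumpWeight X Y i j else 0#)
  H-move (○∷ C) (○∷ D) J r = H-move C D J r
  -- The landing row is 0, and the sum `G<` over all source rows has its only contribution from row
  -- `j`.
  H-move {k = k} {j = j} (○∷ C) (●∷ D) (jump _ J) zero = trans (+-congʳ (zeroʳ _))
    (trans (+-identityˡ _) (proj₁ (G<-if _ k (toℕ j) (G-jump C D J)) (Fin.toℕ<n j)))
  H-move {k = k} (○∷ C) (●∷ D) (jump _ J) (suc r) = H∘0 D (pred k) r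
  H-move (○∷ C) (●∷ D) (skip J) r with code-descending C
  ... | m<m ∷ _ = contradiction m<m (ℕ.<-irrefl ≡.refl)
  H-move (●∷ C) (○∷ D) (jump x<y J) r with code-descending D
  ... | y≤m ∷ _ = contradiction (ℕ.<-≤-trans x<y y≤m) (ℕ.<⇒≯ (ℕ.n<1+n _))
  H-move (●∷ C) (○∷ D) (skip J) r with code-descending D
  ... | m<m ∷ _ = contradiction m<m (ℕ.<-irrefl ≡.refl)
  H-move (●∷ C) (●∷ D) (jump x<x J) r = contradiction x<x (ℕ.<-irrefl ≡.refl)
  H-move {k = k} (●∷ C) (●∷ D) (skip J) zero = trans
    (+-cong (trans (*-congˡ (δ-distinct C D (move-≢ J))) (zeroʳ _)) (G<∘0 D _ k))
    (+-identityˡ 0#)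
  H-move (●∷ C) (●∷ D) (skip J) (suc r) = H-move C D J r

  private
    -- Any particle taken away could land just beyond the end: the first entry of `X` is at most
    -- `m`, hence below `suc m`.
    ¬jump : ∀ {n k m} {c : Config n} {X : Vec ℕ (suc k)} {Y : Vec ℕ k} → Code c m X →
            (∀ i j → ¬ Move i j X (suc m ∷ Y)) → ∀ j → ¬ Take j X Y
    ¬jump {X = _ ∷ _} C ¬J j J = ¬J zero j (jump (s≤s (lookup≤ (code-descending C) zero)) J)

  T-¬move : ∀ {n m k} {c d : Config n} {X Y : Vec ℕ k} → Code c m X → Code d m Y →
            X ≢ Y → (∀ i j → ¬ Move i j X Y) → ∀ r → T r (δ c) d ≈ 0#
  T-¬move []     []     X≢Y ¬J r       = refl
  T-¬move (○∷ C) (○∷ D) X≢Y ¬J r       = T-¬move C D X≢Y ¬J r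
  T-¬move (○∷ C) (●∷ D) X≢Y ¬J zero    =
    trans (+-cong (zeroʳ _) (G-¬take C D (¬jump C ¬J) _ 0)) (+-identityˡ 0#)
  T-¬move (○∷ C) (●∷ D) X≢Y ¬J (suc r) =
    trans (+-cong (T∘0 D r) (G-¬take C D (¬jump C ¬J) _ (suc r))) (+-identityˡ 0#)
  T-¬move (●∷ C) (○∷ D) X≢Y ¬J r       = T∘0 D r
  T-¬move (●∷ C) (●∷ D) X≢Y ¬J zero    = trans
    (+-cong (trans (*-congˡ (δ-distinct C D (X≢Y ∘ ≡.cong (_ ∷_)))) (zeroʳ _)) (G∘0 D _ 0)) (+-identityˡ 0#)
  T-¬move (●∷ C) (●∷ D) X≢Y ¬J (suc r) = trans
    (+-cong (T-¬move C D (X≢Y ∘ ≡.cong (_ ∷_)) (λ i j J → ¬J (suc i) (suc j) (skip J)) r) (G∘0 D _ (suc r)))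
    (+-identityˡ 0#)

  H-¬move : ∀ {n m k} {c d : Config n} {X Y : Vec ℕ k} → Code c m X → Code d m Y →
            X ≢ Y → (∀ i j → ¬ Move i j X Y) → ∀ r → H k r (δ c) d ≈ 0#
  H-¬move []     []     X≢Y ¬J r       = refl
  H-¬move (○∷ C) (○∷ D) X≢Y ¬J r       = H-¬move C D X≢Y ¬J r
  H-¬move {k = k} (○∷ C) (●∷ D) X≢Y ¬J zero    =
    trans (+-cong (zeroʳ _) (G<-zero _ k (G-¬take C D (¬jump C ¬J) _))) (+-identityˡ 0#)
  H-¬move {k = k} (○∷ C) (●∷ D) X≢Y ¬J (suc r) = H∘0 D (pred k) r
  H-¬move {k = k} (●∷ C) (○∷ D) X≢Y ¬J r       = H∘0 D k r
  H-¬move {k = k} (●∷ C) (●∷ D) X≢Y ¬J zero    = trans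
    (+-cong (trans (*-congˡ (δ-distinct C D (X≢Y ∘ ≡.cong (_ ∷_)))) (zeroʳ _)) (G<∘0 D _ k))
    (+-identityˡ 0#)
  H-¬move (●∷ C) (●∷ D) X≢Y ¬J (suc r) =
    H-¬move C D (X≢Y ∘ ≡.cong (_ ∷_)) (λ i j J → ¬J (suc i) (suc j) (skip J)) r

  T-stay : ∀ {n m k} {c : Config n} {X : Vec ℕ k} → Code c m X → ∀ i →
           T (toℕ i) (δ c) c ≈ τ (position X i)
  T-stay (○∷ C) i       = T-stay C i
  T-stay (●∷ C) zero    = trans (+-cong (*-congˡ (δ-same C C)) (G∘0 C _ 0))
    (trans (+-identityʳ _) (trans (*-identityʳ _) (reflexive (≡.cong τ (code-size C)))))
  T-stay (●∷ C) (suc i) = trans (+-cong (T-stay C i) (G∘0 C _ (suc (toℕ i)))) (+-identityʳ _)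

  H-stay : ∀ {n m k} {c : Config n} {X : Vec ℕ k} → Code c m X → ∀ i →
           H k (toℕ i) (δ c) c ≈ τ (position X i)
  H-stay (○∷ C) i       = H-stay C i
  H-stay {k = k} (●∷ C) zero = trans
    (+-cong (*-congˡ (δ-same C C)) (G<∘0 C _ k))
    (trans (+-identityʳ _) (trans (*-identityʳ _) (reflexive (≡.cong τ (code-size C)))))
  H-stay (●∷ C) (suc i) = H-stay C i

-- Ribbons as moves of one particle.

module RibbonShapes where

  open ≡ using (refl; sym; trans; cong; subst)

  -- Numerical form of a ribbon with head in row `i` and tail in row `j`, for `f` the inner and `g`
  -- the outer partition: `step` says that consecutive rows share exactly one column. The same shift
  -- by one appears in `Take`.
  record Shape {k} (f g : Fin k → ℕ) (i j : Fin k) : Set where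
    field
      ordered : i Fin.≤ j
      before  : ∀ r → r Fin.< i → f r ≡ g r
      after   : ∀ r → j Fin.< r → f r ≡ g r
      step    : ∀ r r′ → toℕ r′ ≡ suc (toℕ r) → i Fin.≤ r → r′ Fin.≤ j → g r′ ≡ suc (f r)
      start   : f i ℕ.< g i

  open Shape

  take-before : ∀ {k j} {X : Vec ℕ (suc k)} {Y : Vec ℕ k} → Take j X Y →
                ∀ r s → toℕ s ≡ toℕ r → r Fin.< j → lookup Y s ≡ suc (lookup X r)
  take-before (there J) zero    zero    _ _         = refl
  take-before (there J) (suc r) (suc s) e (s≤s r<j) = take-before J r s (ℕ.suc-injective e) r<j

  take-after : ∀ {k j} {X : Vec ℕ (suc k)} {Y : Vec ℕ k} → Take j X Y →
               ∀ s → toℕ j ℕ.≤ toℕ s → lookup X (suc s) ≡ lookup Y s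
  take-after here      s       _         = refl
  take-after (there J) (suc s) (s≤s j≤s) = take-after J s j≤s

  move⇒shape : ∀ {k i j} {X Y : Vec ℕ k} → Move i j X Y → Shape (lookup X) (lookup Y) i j
  move⇒shape (jump x<y J) = record
    { ordered = z≤n
    ; before  = λ _ ()
    ; after   = λ { (suc r) (s≤s j≤r) → take-after J r j≤r }
    ; step    = λ { r (suc r′) e _ r′<j → take-before J r r′ (ℕ.suc-injective e)
                      (ℕ.≤-trans (ℕ.≤-reflexive (sym e)) r′<j) }
    ; start   = x<y
    }
  move⇒shape {X = X} (skip J) = record
    { ordered = s≤s (ordered S)
    ; before  = λ { zero _ → refl ; (suc r) (s≤s r<i) → before S r r<i }
    ; after   = λ { (suc r) (s≤s j<r) → after S r j<r }
    ; step    = λ { (suc r) (suc r′) e (s≤s i≤r) (s≤s r′≤j) → step S r r′ (ℕ.suc-injective e) i≤r r′≤j }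
    ; start   = start S
    }
    where S = move⇒shape J

  lookup-ext : ∀ {k} {X Y : Vec ℕ k} → (∀ r → lookup X r ≡ lookup Y r) → X ≡ Y
  lookup-ext {X = []}    {[]}    e = refl
  lookup-ext {X = x ∷ X} {y ∷ Y} e = ≡.cong₂ _∷_ (e zero) (lookup-ext (e ∘ suc))

  shape⇒move : ∀ {k i j} {X Y : Vec ℕ k} → Shape (lookup X) (lookup Y) i j → Move i j X Y
  shape⇒move {i = zero} {X = x ∷ X} {y ∷ Y} S =
    jump (start S) (take (λ r s e s<j → step S r (suc s) (cong suc e) z≤n s<j)
                         (λ s j≤s → after S (suc s) (s≤s j≤s)))
    where
    take : ∀ {k j} {X : Vec ℕ (suc k)} {Y : Vec ℕ k} →
           (∀ r s → toℕ s ≡ toℕ r → suc (toℕ s) ℕ.≤ toℕ j → lookup Y s ≡ suc (lookup X r)) →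
           (∀ s → toℕ j ℕ.≤ toℕ s → lookup X (suc s) ≡ lookup Y s) → Take j X Y
    take {j = zero} {x ∷ X} {Y} lo hi with refl ← lookup-ext {X = X} {Y} (λ s → hi s z≤n) = here
    take {j = suc j} {x ∷ X} {y ∷ Y} lo hi with refl ← lo zero zero refl (s≤s z≤n) =
      there (take (λ r s e s<j → lo (suc r) (suc s) (cong suc e) (s≤s s<j)) (λ s j≤s → hi (suc s) (s≤s j≤s)))
  shape⇒move {i = suc i} {zero}  S with () ← ordered S
  shape⇒move {i = suc i} {suc j} {x ∷ X} {y ∷ Y} S with refl ← before S zero (s≤s z≤n) =
    skip (shape⇒move record
      { ordered = ℕ.s≤s⁻¹ (ordered S)
      ; before  = λ r r<i → before S (suc r) (s≤s r<i)
      ; after   = λ r j<r → after S (suc r) (s≤s j<r)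
      ; step    = λ r r′ e i≤r r′≤j → step S (suc r) (suc r′) (cong suc e) (s≤s i≤r) (s≤s r′≤j)
      ; start   = start S
      })

  shape-resp : ∀ {k i j} {f f′ g g′ : Fin k → ℕ} → (∀ r → f r ≡ f′ r) → (∀ r → g r ≡ g′ r) →
               Shape f g i j → Shape f′ g′ i j
  shape-resp f≡ g≡ S = record
    { ordered = ordered S
    ; before  = λ r r<i → trans (sym (f≡ r)) (trans (before S r r<i) (g≡ r))
    ; after   = λ r j<r → trans (sym (f≡ r)) (trans (after S r j<r) (g≡ r))
    ; step    = λ r r′ e i≤r r′≤j → trans (sym (g≡ r′)) (trans (step S r r′ e i≤r r′≤j) (cong suc (f≡ r)))
    ; start   = ≡.subst₂ ℕ._<_ (f≡ _) (g≡ _) (start S)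
    }

  -- A ribbon meets an interval of rows and an interval of columns, which this counts. The
  -- enumeration `f` is arbitrary so that the induction can pass to `f ∘ suc`.
  length-filter-interval : ∀ {a} {A : Set a} {P : A → Set} (P? : Unary.Decidable P) n (f : Fin n → A) lo hi →
    hi ℕ.≤ n → (∀ x → P (f x) → lo ℕ.≤ toℕ x × toℕ x ℕ.< hi) →
    (∀ x → lo ℕ.≤ toℕ x → toℕ x ℕ.< hi → P (f x)) →
    length (filter P? (List.tabulate f)) ≡ hi ∸ lo
  length-filter-interval P? zero    f lo .zero z≤n to from = sym (ℕ.0∸n≡0 lo)
  length-filter-interval P? (suc n) f lo hi hi≤n to from with P? (f zero)
  length-filter-interval P? (suc n) f lo hi hi≤n to from | yes p with to zero p
  length-filter-interval P? (suc n) f zero (suc hi) (s≤s hi≤n) to from | yes p | _ =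
    cong suc (length-filter-interval P? n (f ∘ suc) zero hi hi≤n
      (λ x px → z≤n , ℕ.s≤s⁻¹ (proj₂ (to (suc x) px))) (λ x _ x<hi → from (suc x) z≤n (s≤s x<hi)))
  length-filter-interval P? (suc n) f lo zero hi≤n to from | no ¬p =
    trans (length-filter-interval P? n (f ∘ suc) zero zero z≤n
      (λ x px → contradiction (proj₂ (to (suc x) px)) λ ()) (λ _ _ ())) (sym (ℕ.0∸n≡0 lo))
  length-filter-interval P? (suc n) f zero (suc hi) hi≤n to from | no ¬p =
    contradiction (from zero z≤n (s≤s z≤n)) ¬p
  length-filter-interval P? (suc n) f (suc lo) (suc hi) (s≤s hi≤n) to from | no ¬p =
    length-filter-interval P? n (f ∘ suc) lo hi hi≤n
      (λ x px → ℕ.s≤s⁻¹ (proj₁ (to (suc x) px)) , ℕ.s≤s⁻¹ (proj₂ (to (suc x) px)))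
      (λ x lo≤x x<hi → from (suc x) (s≤s lo≤x) (s≤s x<hi))

  previous : ∀ {k} (r : Fin k) → 0 ℕ.< toℕ r → ∃ λ (r₀ : Fin k) → toℕ r ≡ suc (toℕ r₀)
  previous (suc r) _ = inject₁ r , cong suc (sym (Fin.toℕ-inject₁ r))

  module _ {m k : ℕ} where

    rows : Partition m k → Vec ℕ k
    rows ν = Vec.map toℕ (parts ν)

    lookup-rows : ∀ ν r → lookup (rows ν) r ≡ part ν r
    lookup-rows ν r = Vec.lookup-map r toℕ (parts ν)

    part≤ : ∀ (ν : Partition m k) r → part ν r ℕ.≤ m
    part≤ ν r = ℕ.s≤s⁻¹ (Fin.toℕ<n (lookup (parts ν) r))

    module _ {μ ν : Partition m k} where

      column : ∀ r x → part ν r ℕ.≤ x → x ℕ.< part μ r → ∃ λ (y : Fin m) → toℕ y ≡ x × (r , y) ∈[ μ / ν ]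
      column r x ν≤x x<μ = y , y≡x , subst (part ν r ℕ.≤_) (sym y≡x) ν≤x , subst (ℕ._< part μ r) (sym y≡x) x<μ
        where
        x<m = ℕ.<-≤-trans x<μ (part≤ μ r)
        y = fromℕ< x<m
        y≡x = Fin.toℕ-fromℕ< x<m

      -- Such a path has a vertical step from row `r` down to row `r′`, and the column of that step
      -- lies in both rows.
      crossing : ∀ {r r′} → toℕ r′ ≡ suc (toℕ r) → ∀ {x y} → Star (Step μ ν) x y →
                 proj₁ x Fin.≤ r → r Fin.< proj₁ y → part ν r ℕ.< part μ r′
      crossing e ε x≤r r<x = contradiction (ℕ.<-≤-trans r<x x≤r) (ℕ.<-irrefl refl)
      crossing {r} {r′} e {x₁ , x₂} (_◅_ {j = z₁ , z₂} (x∈ , z∈ , adj) zs) x≤r r<y with z₁ Fin.≤? r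
      ... | yes z≤r = crossing e zs z≤r r<y
      ... | no  z≰r = ℕ.≤-<-trans
              (subst (λ s → part ν s ℕ.≤ toℕ z₂) x₁≡r (subst (part ν x₁ ℕ.≤_) x₂≡z₂ (proj₁ x∈)))
              (subst (λ s → toℕ z₂ ℕ.< part μ s) z₁≡r′ (proj₂ z∈))
        where
        r<z : toℕ r ℕ.< toℕ z₁
        r<z = ℕ.≰⇒> z≰r
        x<z : toℕ x₁ ℕ.< toℕ z₁
        x<z = ℕ.≤-<-trans x≤r r<z
        -- The row numbers differ, so they use up the whole distance 1 and the columns agree.
        sum≡1 : (toℕ z₁ ∸ toℕ x₁) ℕ.+ ∣ toℕ x₂ - toℕ z₂ ∣ ≡ 1
        sum≡1 = trans (cong (ℕ._+ _) (sym (ℕ.m≤n⇒∣m-n∣≡n∸m (ℕ.<⇒≤ x<z)))) adj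
        split : ∀ {a b} → 0 ℕ.< a → a ℕ.+ b ≡ 1 → a ≡ 1 × b ≡ 0
        split {suc zero} _ e = refl , ℕ.suc-injective e
        z≡1+x : toℕ z₁ ≡ suc (toℕ x₁)
        z≡1+x = trans (sym (ℕ.m∸n+n≡m (ℕ.<⇒≤ x<z)))
          (cong (ℕ._+ toℕ x₁) (proj₁ (split (ℕ.m<n⇒0<n∸m x<z) sum≡1)))
        x₂≡z₂ : toℕ x₂ ≡ toℕ z₂
        x₂≡z₂ = ℕ.∣m-n∣≡0⇒m≡n (proj₂ (split (ℕ.m<n⇒0<n∸m x<z) sum≡1))
        x₁≡r : x₁ ≡ r
        x₁≡r = Fin.toℕ-injective (ℕ.≤-antisym x≤r (ℕ.s≤s⁻¹ (subst (toℕ r ℕ.<_) z≡1+x r<z)))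
        z₁≡r′ : z₁ ≡ r′
        z₁≡r′ = Fin.toℕ-injective (trans z≡1+x (trans (cong (suc ∘ toℕ) x₁≡r) (sym e)))

      -- Consecutive rows share at least one column by connectedness, through `crossing`, and at
      -- most one because two shared columns would contain a square.
      ribbon⇒shape : (η : IsRibbon μ ν) → Shape (part ν) (part μ) (headRow η) (tailRow η)
      ribbon⇒shape η = record
        { ordered = proj₁ (proj₂ tail (proj₁ (hasHead η)) (proj₁ head))
        ; before  = λ r r<i → equal r (ℕ.<⇒≱ r<i ∘ proj₁ ∘ within r)
        ; after   = λ r j<r → equal r (ℕ.<⇒≱ j<r ∘ proj₂ ∘ within r)
        ; step    = λ r r′ e i≤r r′≤j → ℕ.≤-antisym (ℕ.≮⇒≥ (overlap≤1 r r′ e))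
            (crossing e (connected _ _ (proj₁ head) (proj₁ tail)) i≤r (subst (ℕ._≤ toℕ (tailRow η)) e r′≤j))
        ; start   = ℕ.≤-<-trans (proj₁ (proj₁ head)) (proj₂ (proj₁ head))
        }
        where
        open IsRibbon η
        head = proj₂ (hasHead η)
        tail = proj₂ (hasTail η)
        within : ∀ r → part ν r ℕ.< part μ r → headRow η Fin.≤ r × r Fin.≤ tailRow η
        within r ν<μ with y , _ , y∈ ← column r (part ν r) ℕ.≤-refl ν<μ =
          proj₁ (proj₂ head (r , y) y∈) , proj₁ (proj₂ tail (r , y) y∈)
        equal : ∀ r → ¬ part ν r ℕ.< part μ r → part ν r ≡ part μ r
        equal r ν≮μ = ℕ.≤-antisym (contained r) (ℕ.≮⇒≥ ν≮μ)
        -- The square would lie in the columns `part ν r` and `suc (part ν r)`.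
        overlap≤1 : ∀ r r′ → toℕ r′ ≡ suc (toℕ r) → ¬ suc (part ν r) ℕ.< part μ r′
        overlap≤1 r r′ e 1+ν<μ = no-square r r′ y y′ (e , trans y′≡ (cong suc (sym y≡)) , y∈ , y′∈ ,
            (ℕ.≤-trans ν′≤ν (proj₁ y∈) , subst (ℕ._< part μ r′) (sym y≡) ν<μ′) ,
            (ℕ.≤-trans ν′≤ν (proj₁ y′∈) , subst (ℕ._< part μ r′) (sym y′≡) 1+ν<μ))
          where
          r≤r′ : r Fin.≤ r′
          r≤r′ = subst (toℕ r ℕ.≤_) (sym e) (ℕ.n≤1+n _)
          μ′≤μ = part-mono μ r≤r′
          ν′≤ν = part-mono ν r≤r′
          ν<μ′ : part ν r ℕ.< part μ r′
          ν<μ′ = ℕ.<-trans (ℕ.n<1+n _) 1+ν<μ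
          left  = column r (part ν r) ℕ.≤-refl (ℕ.<-≤-trans ν<μ′ μ′≤μ)
          right = column r (suc (part ν r)) (ℕ.n≤1+n _) (ℕ.<-≤-trans 1+ν<μ μ′≤μ)
          y  = proj₁ left
          y′ = proj₁ right
          y≡  = proj₁ (proj₂ left)
          y′≡ = proj₁ (proj₂ right)
          y∈  = proj₂ (proj₂ left)
          y′∈ = proj₂ (proj₂ right)

      module _ {i j : Fin k} (S : Shape (part ν) (part μ) i j) where

        private
          -- Consecutive rows overlap in the single column part ν r₀.
          above : ∀ r → i Fin.≤ r → r Fin.≤ j → i ≢ r →
                  ∃ λ r₀ → toℕ r ≡ suc (toℕ r₀) × i Fin.≤ r₀ × r₀ Fin.≤ j
                       × part μ r ≡ suc (part ν r₀) × part ν r ℕ.≤ part ν r₀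
          above r i≤r r≤j i≢r with r₀ , e ← previous r (ℕ.≤-<-trans z≤n (Fin.≤∧≢⇒< i≤r i≢r)) =
            r₀ , e , i≤r₀ , ℕ.≤-trans r₀≤r r≤j , step S r₀ r e i≤r₀ r≤j , part-mono ν r₀≤r
            where
            i≤r₀ = ℕ.s≤s⁻¹ (subst (toℕ i ℕ.<_) e (Fin.≤∧≢⇒< i≤r i≢r))
            r₀≤r : r₀ Fin.≤ r
            r₀≤r = subst (toℕ r₀ ℕ.≤_) (sym e) (ℕ.n≤1+n _)

        shape-inside : ∀ r → i Fin.≤ r → r Fin.≤ j → part ν r ℕ.< part μ r
        shape-inside r i≤r r≤j with i Fin.≟ r
        ... | yes refl = start S
        ... | no  i≢r with _ , _ , _ , _ , μ≡ , ν≤ν₀ ← above r i≤r r≤j i≢r =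
          subst (part ν r ℕ.<_) (sym μ≡) (s≤s ν≤ν₀)

        shape-within : ∀ r → part ν r ℕ.< part μ r → i Fin.≤ r × r Fin.≤ j
        shape-within r ν<μ = ℕ.≮⇒≥ (λ r<i → ℕ.<-irrefl (before S r r<i) ν<μ)
                           , ℕ.≮⇒≥ (λ j<r → ℕ.<-irrefl (after S r j<r) ν<μ)

        private
          meets : ∀ {r x} → (r , x) ∈[ μ / ν ] → part ν r ℕ.< part μ r
          meets (ν≤x , x<μ) = ℕ.≤-<-trans ν≤x x<μ

          symmetric : ∀ {x y} → Step μ ν x y → Step μ ν y x
          symmetric {x₁ , x₂} {y₁ , y₂} (x∈ , y∈ , adj) = y∈ , x∈ ,
            trans (≡.cong₂ ℕ._+_ (ℕ.∣-∣-comm (toℕ y₁) (toℕ x₁)) (ℕ.∣-∣-comm (toℕ y₂) (toℕ x₂))) adj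

          leftwards : ∀ d {r x y} → toℕ x ≡ d ℕ.+ toℕ y → (r , x) ∈[ μ / ν ] → (r , y) ∈[ μ / ν ] →
                      Star (Step μ ν) (r , x) (r , y)
          leftwards zero e x∈ y∈ with refl ← Fin.toℕ-injective e = ε
          leftwards (suc d) {r} {suc x} {y} e x∈ y∈ = (x∈ , x′∈ , adj) ◅ leftwards d x′≡ x′∈ y∈
            where
            x′≡ : toℕ (inject₁ x) ≡ d ℕ.+ toℕ y
            x′≡ = trans (Fin.toℕ-inject₁ x) (ℕ.suc-injective e)
            x′∈ : (r , inject₁ x) ∈[ μ / ν ]
            x′∈ = ℕ.≤-trans (proj₁ y∈) (subst (toℕ y ℕ.≤_) (sym x′≡) (ℕ.m≤n+m _ d))
                , ℕ.<-trans (s≤s (ℕ.≤-reflexive (Fin.toℕ-inject₁ x))) (proj₂ x∈)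
            adj : ∣ toℕ r - toℕ r ∣ ℕ.+ ∣ suc (toℕ x) - toℕ (inject₁ x) ∣ ≡ 1
            adj rewrite ℕ.∣n-n∣≡0 (toℕ r) | Fin.toℕ-inject₁ x =
              trans (ℕ.m≤n⇒∣n-m∣≡n∸m (ℕ.n≤1+n (toℕ x))) (ℕ.m+n∸n≡m 1 (toℕ x))

          sameRow : ∀ {r x y} → (r , x) ∈[ μ / ν ] → (r , y) ∈[ μ / ν ] → Star (Step μ ν) (r , x) (r , y)
          sameRow {r} {x} {y} x∈ y∈ with ℕ.≤-total (toℕ x) (toℕ y)
          ... | inj₁ x≤y = Star.reverse symmetric (leftwards _ (sym (ℕ.m∸n+n≡m x≤y)) y∈ x∈)
          ... | inj₂ y≤x = leftwards _ (sym (ℕ.m∸n+n≡m y≤x)) x∈ y∈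

          anchor = column i (part ν i) ℕ.≤-refl (start S)

          -- Every box is joined to the leftmost box of the head row by moving along its row to the
          -- column shared with the row above and climbing there; `n` is the row number, on which
          -- the recursion runs.
          toAnchor : ∀ n r → toℕ r ≡ n → ∀ {x} → (r , x) ∈[ μ / ν ] →
                     Star (Step μ ν) (r , x) (i , proj₁ anchor)
          toAnchor n r r≡n x∈ with i Fin.≟ r | shape-within r (meets x∈)
          ... | yes refl | _ = sameRow x∈ (proj₂ (proj₂ anchor))
          toAnchor zero r r≡0 x∈ | no i≢r | i≤r , r≤j =
            contradiction (Fin.≤∧≢⇒< i≤r i≢r) (subst (λ n → ¬ toℕ i ℕ.< n) (sym r≡0) λ ())
          toAnchor (suc n) r r≡n x∈ | no i≢r | i≤r , r≤j
            with r₀ , e , i≤r₀ , r₀≤j , μ≡ , ν≤ν₀ ← above r i≤r r≤j i≢r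
            with y , y≡ , y∈₀ ← column r₀ (part ν r₀) ℕ.≤-refl (shape-inside r₀ i≤r₀ r₀≤j) =
            sameRow x∈ y∈ ◅◅ (y∈ , y∈₀ , adj) ◅ toAnchor n r₀ (ℕ.suc-injective (trans (sym e) r≡n)) y∈₀
            where
            y∈ : (r , y) ∈[ μ / ν ]
            y∈ = subst (part ν r ℕ.≤_) (sym y≡) ν≤ν₀ , ℕ.≤-reflexive (trans (cong suc y≡) (sym μ≡))
            adj : ∣ toℕ r - toℕ r₀ ∣ ℕ.+ ∣ toℕ y - toℕ y ∣ ≡ 1
            adj rewrite e | ℕ.∣n-n∣≡0 (toℕ y) = trans (ℕ.+-identityʳ _)
              (trans (ℕ.m≤n⇒∣n-m∣≡n∸m (ℕ.n≤1+n (toℕ r₀))) (ℕ.m+n∸n≡m 1 (toℕ r₀)))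

        shape⇒ribbon : IsRibbon μ ν
        shape⇒ribbon = mkRibbon contained ((i , proj₁ anchor) , proj₂ (proj₂ anchor)) connected no-square
          where
          contained : ∀ r → part ν r ℕ.≤ part μ r
          contained r with r Fin.<? i | j Fin.<? r
          ... | yes r<i | _       = ℕ.≤-reflexive (before S r r<i)
          ... | no  _   | yes j<r = ℕ.≤-reflexive (after S r j<r)
          ... | no  r≮i | no  j≮r = ℕ.<⇒≤ (shape-inside r (ℕ.≮⇒≥ r≮i) (ℕ.≮⇒≥ j≮r))
          connected : Connected μ ν
          connected x y x∈ y∈ = toAnchor _ _ refl x∈ ◅◅ Star.reverse symmetric (toAnchor _ _ refl y∈)
          no-square : ∀ r r′ x x′ → ¬ Square μ ν r r′ x x′
          -- The right column of a square is at least `suc (part ν r)`, but by `step` row `r′` ends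
          -- before that column.
          no-square r r′ x x′ (r′≡ , x′≡ , x∈ , _ , _ , x′∈) = ℕ.<-irrefl refl (begin-strict
            suc (part ν r)  ≤⟨ s≤s (proj₁ x∈) ⟩
            suc (toℕ x)     ≡⟨ x′≡ ⟨
            toℕ x′          <⟨ proj₂ x′∈ ⟩
            part μ r′       ≡⟨ step S r r′ r′≡ (proj₁ (shape-within r (meets x∈)))
                                                (proj₂ (shape-within r′ (meets x′∈))) ⟩
            suc (part ν r)  ∎)
            where open ℕ.≤-Reasoning

        shape-ht : ht μ ν ≡ suc (toℕ j) ∸ toℕ i
        shape-ht = length-filter-interval (rowMeets? μ ν) k id (toℕ i) (suc (toℕ j)) (Fin.toℕ<n j)
          (λ r (x , x∈) → let i≤r , r≤j = shape-within r (meets x∈) in i≤r , s≤s r≤j)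
          (λ r i≤r r≤j →
             let y , _ , y∈ = column r (part ν r) ℕ.≤-refl (shape-inside r i≤r (ℕ.s≤s⁻¹ r≤j)) in y , y∈)

        shape-wd : wd μ ν ≡ part μ i ∸ part ν j
        shape-wd = length-filter-interval (colMeets? μ ν) m id (part ν j) (part μ i) (part≤ μ i)
          (λ x (r , x∈) → let i≤r , r≤j = shape-within r (meets x∈) in
             ℕ.≤-trans (part-mono ν r≤j) (proj₁ x∈) , ℕ.<-≤-trans (proj₂ x∈) (part-mono μ i≤r))
          (λ x ν≤x x<μ → find x<μ _ j refl (ordered S) ℕ.≤-refl ν≤x)
          where
          -- The search climbs from the tail row. If row `r` ends before column `x`, then `step`
          -- shows that the row above starts at or before `x`; the head row extends beyond `x`.
          find : ∀ {x} → toℕ x ℕ.< part μ i → ∀ n r → toℕ r ≡ n → i Fin.≤ r → r Fin.≤ j → part ν r ℕ.≤ toℕ x →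
                 ∃ λ s → (s , x) ∈[ μ / ν ]
          find {x} x<μi n r r≡n i≤r r≤j ν≤x with toℕ x ℕ.<? part μ r | i Fin.≟ r
          ... | yes x<μ | _        = r , ν≤x , x<μ
          ... | no  x≮μ | yes refl = contradiction x<μi x≮μ
          find x<μi zero    r r≡0 i≤r r≤j ν≤x | no x≮μ | no i≢r =
            contradiction (Fin.≤∧≢⇒< i≤r i≢r) (subst (λ n → ¬ toℕ i ℕ.< n) (sym r≡0) λ ())
          find x<μi (suc n) r r≡n i≤r r≤j ν≤x | no x≮μ | no i≢r
            with r₀ , e , i≤r₀ , r₀≤j , μ≡ , _ ← above r i≤r r≤j i≢r =
            find x<μi n r₀ (ℕ.suc-injective (trans (sym e) r≡n)) i≤r₀ r₀≤j
              (ℕ.≤-trans (ℕ.n≤1+n _) (subst (ℕ._≤ _) μ≡ (ℕ.≮⇒≥ x≮μ)))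

      ribbon⇒move : (η : IsRibbon μ ν) → Move (headRow η) (tailRow η) (rows ν) (rows μ)
      ribbon⇒move η = shape⇒move (shape-resp (sym ∘ lookup-rows ν) (sym ∘ lookup-rows μ) (ribbon⇒shape η))

      move⇒ribbon : ∀ {i j} → Move i j (rows ν) (rows μ) → IsRibbon μ ν
      move⇒ribbon J = shape⇒ribbon (shape-resp (lookup-rows ν) (lookup-rows μ) (move⇒shape J))

open RibbonShapes

-- Increasing index sequences, split by whether they contain 0.

∈-increasing⁺ : ∀ {k r} {is : Vec (Fin k) r} → Linked Fin._<_ is → is ∈ increasing k r
∈-increasing⁺ {is = is} L = ∈.∈-filter⁺ (linked? Fin._<?_) (∈-vectors is) L

∈-increasing⁻ : ∀ {k r} {is : Vec (Fin k) r} → is ∈ increasing k r → Linked Fin._<_ is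
∈-increasing⁻ {k} {r} is∈ = proj₂ (∈.∈-filter⁻ (linked? Fin._<?_) {xs = vectors k r} is∈)

increasing-unique : ∀ k r → Unique (increasing k r)
increasing-unique k r = Unique.filter⁺ (linked? Fin._<?_) (vectors-unique k r)

map-injective : ∀ {a b} {A : Set a} {B : Set b} {f : A → B} → (∀ {x y} → f x ≡ f y → x ≡ y) →
                ∀ {n} {xs ys : Vec A n} → Vec.map f xs ≡ Vec.map f ys → xs ≡ ys
map-injective f-inj {xs = []}     {[]}     _ = ≡.refl
map-injective f-inj {xs = x ∷ xs} {y ∷ ys} e =
  ≡.cong₂ _∷_ (f-inj (Vec.∷-injectiveˡ e)) (map-injective f-inj (Vec.∷-injectiveʳ e))

-- Both lists are free of repetitions and have the same members, so each is a permutation of the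
-- other.
increasing-split : ∀ k r → increasing (suc k) (suc r) ↭
  List.map (λ is → zero ∷ Vec.map suc is) (increasing k r) ++ List.map (Vec.map suc) (increasing k (suc r))
increasing-split k r = ∼bag⇒↭ (unique∧set⇒bag (increasing-unique (suc k) (suc r))
  (Unique.++⁺ (Unique.map⁺ (map-injective Fin.suc-injective ∘ Vec.∷-injectiveʳ) (increasing-unique k r))
              (Unique.map⁺ (map-injective Fin.suc-injective) (increasing-unique k (suc r)))
              disjoint)
  (mk⇔ (split _ ∘ ∈-increasing⁻) (∈-increasing⁺ ∘ merge)))
  where
  with0 = λ (is : Vec (Fin k) r) → zero ∷ Vec.map suc is
  disjoint : ∀ {is} → ¬ (is ∈ List.map with0 (increasing k r)
                        × is ∈ List.map (Vec.map suc) (increasing k (suc r)))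
  disjoint (is∈ , is∈′) with ∈.∈-map⁻ with0 is∈ | ∈.∈-map⁻ (Vec.map suc) is∈′
  ... | _ , _ , ≡.refl | _ ∷ _ , _ , ()
  -- Whatever follows an entry of a strictly increasing sequence is positive, hence a successor.
  positive : ∀ {r i} {is : Vec (Fin (suc k)) r} → Linked Fin._<_ (i ∷ is) → ∃ λ js → is ≡ Vec.map suc js
  positive {is = []}         [-]        = [] , ≡.refl
  positive {is = suc j ∷ is} (_ ∷ L) with js , ≡.refl ← positive L = j ∷ js , ≡.refl
  shifted : ∀ {r} {is : Vec (Fin k) r} → Linked Fin._<_ (Vec.map suc is) → Linked Fin._<_ is
  shifted L = Linked.map ℕ.s≤s⁻¹ (Linked.map⁻ L)
  shift : ∀ {r} {is : Vec (Fin k) r} → Linked Fin._<_ is → Linked Fin._<_ (Vec.map suc is)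
  shift L = Linked.map⁺ (Linked.map s≤s L)
  split : ∀ is → Linked Fin._<_ is →
          is ∈ List.map with0 (increasing k r) ++ List.map (Vec.map suc) (increasing k (suc r))
  split (zero ∷ is) L with js , ≡.refl ← positive L =
    ∈.∈-++⁺ˡ (∈.∈-map⁺ with0 (∈-increasing⁺ (shifted (Linked.tail L))))
  split (suc i ∷ is) L with js , ≡.refl ← positive L =
    ∈.∈-++⁺ʳ (List.map with0 (increasing k r))
      (∈.∈-map⁺ (Vec.map suc) {x = i ∷ js} (∈-increasing⁺ (shifted L)))
  merge : ∀ {is} → is ∈ List.map with0 (increasing k r) ++ List.map (Vec.map suc) (increasing k (suc r)) →
          Linked Fin._<_ is
  merge is∈ with ∈.∈-++⁻ (List.map with0 (increasing k r)) is∈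
  ... | inj₁ is∈ with js , js∈ , ≡.refl ← ∈.∈-map⁻ with0 is∈ = cons0 (∈-increasing⁻ js∈)
    where
    cons0 : ∀ {r} {js : Vec (Fin k) r} → Linked Fin._<_ js → Linked Fin._<_ (zero ∷ Vec.map suc js)
    cons0 []             = [-]
    cons0 L@([-])        = s≤s z≤n ∷ shift L
    cons0 L@(_∷_ {xs = _ ∷ _} _ _) = s≤s z≤n ∷ shift L
  ... | inj₂ is∈ with js , js∈ , ≡.refl ← ∈.∈-map⁻ (Vec.map suc) is∈ = shift (∈-increasing⁻ js∈)

-- Partitions as descending sequences.

linked⇒descending : ∀ {m k} {v : Vec (Fin (suc m)) k} → Linked Fin._≥_ v → Descending m (Vec.map toℕ v)
linked⇒descending []  = []
linked⇒descending {v = x ∷ []} [-] = ℕ.s≤s⁻¹ (Fin.toℕ<n x) ∷ []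
linked⇒descending {v = x ∷ _ ∷ _} (y≤x ∷ L) with linked⇒descending L
... | _ ∷ D = ℕ.s≤s⁻¹ (Fin.toℕ<n x) ∷ y≤x ∷ D

-- The bound `m` shrinks along the recursion while the type `Fin (suc m′)` of the entries stays
-- fixed.
descending⇒linked : ∀ {m m′ k} {X : Vec ℕ k} → m ≤ m′ → Descending m X →
                    ∃ λ (v : Vec (Fin (suc m′)) k) → Linked Fin._≥_ v × Vec.map toℕ v ≡ X
descending⇒linked m≤m′ [] = [] , [] , ≡.refl
descending⇒linked {m′ = m′} m≤m′ (_∷_ {x = x} x≤m D) = go D (descending⇒linked x≤m′ D)
  where
  x≤m′ = ℕ.≤-trans x≤m m≤m′
  x′ = fromℕ< (s≤s x≤m′)
  x′≡x = Fin.toℕ-fromℕ< (s≤s x≤m′)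
  go : ∀ {k} {X : Vec ℕ k} → Descending x X →
       (∃ λ (v : Vec (Fin (suc m′)) k) → Linked Fin._≥_ v × Vec.map toℕ v ≡ X) →
       ∃ λ v → Linked Fin._≥_ v × Vec.map toℕ v ≡ x ∷ X
  go []        ([]    , _ , ≡.refl) = x′ ∷ [] , [-] , ≡.cong (_∷ []) x′≡x
  go (y≤x ∷ _) (y ∷ v , L , ≡.refl) =
    x′ ∷ y ∷ v , ≡.subst (toℕ y ≤_) (≡.sym x′≡x) y≤x ∷ L , ≡.cong (_∷ Vec.map toℕ (y ∷ v)) x′≡x

rows-descending : ∀ {m k} (ν : Partition m k) → Descending m (rows ν)
rows-descending ν = linked⇒descending (parts-decreasing ν)

rows-surjective : ∀ {m k} {X : Vec ℕ k} → Descending m X → ∃ λ (ν : Partition m k) → rows ν ≡ X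
rows-surjective D with v , L , e ← descending⇒linked ℕ.≤-refl D = mkPartition v L , e

rows-injective : ∀ {m k} {ν μ : Partition m k} → rows ν ≡ rows μ → ν ≡ μ
rows-injective {ν = mkPartition u _} {mkPartition v _} e
  with ≡.refl ← map-injective Fin.toℕ-injective {xs = u} {v} e = ≡.refl

-- Finite sums in the ring.

module Sums {c ℓ} (R : CommutativeRing c ℓ) where

  open CommutativeRing R hiding (zero)
  open RingSolver commutativeSemiring using (solve; _:=_; _:+_; _:*_)
  open SetoidReasoning setoid
  open Functions R
  open Linear

  sum : ∀ {a} {A : Set a} → List A → (A → Carrier) → Carrier
  sum []       f = 0#
  sum (x ∷ xs) f = f x + sum xs f

  module _ {a} {A : Set a} where

    sum-cong : ∀ (xs : List A) {f g} → (∀ x → f x ≈ g x) → sum xs f ≈ sum xs g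
    sum-cong []       f≈g = refl
    sum-cong (x ∷ xs) f≈g = +-cong (f≈g x) (sum-cong xs f≈g)

    sum-0 : ∀ (xs : List A) → sum xs (λ _ → 0#) ≈ 0#
    sum-0 []       = refl
    sum-0 (x ∷ xs) = trans (+-identityˡ _) (sum-0 xs)

    sum-+ : ∀ (xs : List A) f g → sum xs (λ x → f x + g x) ≈ sum xs f + sum xs g
    sum-+ []       f g = sym (+-identityˡ 0#)
    sum-+ (x ∷ xs) f g = trans (+-congˡ (sum-+ xs f g))
      (solve 4 (λ a b c d → (a :+ b) :+ (c :+ d) := (a :+ c) :+ (b :+ d)) refl _ _ _ _)

    sum-*ˡ : ∀ (xs : List A) a f → a * sum xs f ≈ sum xs (λ x → a * f x)
    sum-*ˡ []       a f = zeroʳ a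
    sum-*ˡ (x ∷ xs) a f = trans (distribˡ a _ _) (+-congˡ (sum-*ˡ xs a f))

    sum-++ : ∀ (xs ys : List A) f → sum (xs ++ ys) f ≈ sum xs f + sum ys f
    sum-++ []       ys f = sym (+-identityˡ _)
    sum-++ (x ∷ xs) ys f = trans (+-congˡ (sum-++ xs ys f)) (sym (+-assoc _ _ _))

    sum-↭ : ∀ {xs ys : List A} → xs ↭ ys → ∀ f → sum xs f ≈ sum ys f
    sum-↭ ↭.refl         f = refl
    sum-↭ (↭.prep x p)   f = +-congˡ (sum-↭ p f)
    sum-↭ (↭.swap x y p) f = trans (+-congˡ (+-congˡ (sum-↭ p f)))
      (solve 3 (λ a b c → a :+ (b :+ c) := b :+ (a :+ c)) refl _ _ _)
    sum-↭ (↭.trans p p′) f = trans (sum-↭ p f) (sum-↭ p′ f)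

    sum-map : ∀ {b} {B : Set b} (ϕ : B → A) (xs : List B) f → sum (List.map ϕ xs) f ≡ sum xs (f ∘ ϕ)
    sum-map ϕ []       f = ≡.refl
    sum-map ϕ (x ∷ xs) f = ≡.cong (f (ϕ x) +_) (sum-map ϕ xs f)

    sum-single : ∀ {xs : List A} {x} → Unique xs → x ∈ xs → (f : A → Carrier) →
                 (∀ y → x ≢ y → f y ≈ 0#) → sum xs f ≈ f x
    sum-single (x∉ ∷ u) (here ≡.refl) f f≈0 = trans (+-congˡ (vanish x∉)) (+-identityʳ _)
      where
      vanish : ∀ {ys} → All.All (_ ≢_) ys → sum ys f ≈ 0#
      vanish All.[]           = refl
      vanish (x≢y All.∷ x∉) = trans (+-cong (f≈0 _ x≢y) (vanish x∉)) (+-identityˡ 0#)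
    sum-single (y∉ ∷ u) (there x∈) f f≈0 =
      trans (+-cong (f≈0 _ (All.lookup y∉ x∈ ∘ ≡.sym)) (sum-single u x∈ f f≈0)) (+-identityˡ _)

    linear-sum : ∀ {n} {F : Op n} → Linear F → ∀ (xs : List A) (w : A → Carrier) (v : A → Fun n) →
                 F (λ c → sum xs (λ x → w x * v x c)) ≋ λ c → sum xs (λ x → w x * F (v x) c)
    linear-sum L []       w v c = zero-preserving L c
    linear-sum L (x ∷ xs) w v c = trans (linear L (w x) _ _ c) (+-congˡ (linear-sum L xs w v c))

  sum-swap : ∀ {a b} {A : Set a} {B : Set b} (xs : List A) (ys : List B) (f : A → B → Carrier) →
             sum xs (λ x → sum ys (f x)) ≈ sum ys (λ y → sum xs (λ x → f x y))
  sum-swap []       ys f = sym (sum-0 ys)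
  sum-swap (x ∷ xs) ys f = trans (+-congˡ (sum-swap xs ys f)) (sym (sum-+ ys (f x) _))

  sum-increasing : ∀ k r f → sum (increasing (suc k) (suc r)) f ≈
    sum (increasing k r) (λ is → f (zero ∷ Vec.map suc is)) + sum (increasing k (suc r)) (f ∘ Vec.map suc)
  sum-increasing k r f = begin
    sum (increasing (suc k) (suc r)) f
      ≈⟨ sum-↭ (increasing-split k r) f ⟩
    sum (List.map _ (increasing k r) ++ List.map (Vec.map suc) (increasing k (suc r))) f
      ≈⟨ sum-++ (List.map _ (increasing k r)) _ f ⟩
    sum (List.map _ (increasing k r)) f + sum (List.map (Vec.map suc) (increasing k (suc r))) f
      ≡⟨ ≡.cong₂ _+_ (sum-map _ (increasing k r) f) (sum-map _ (increasing k (suc r)) f) ⟩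
    _ ∎

-- Transfer to the operators on partitions.

module Assembly {c ℓ} (R : CommutativeRing c ℓ) (n k : ℕ) (k≤n : k ≤ n)
  (p q ħ : CommutativeRing.Carrier R) (τ : Fin n → CommutativeRing.Carrier R) where

  open CommutativeRing R hiding (zero)
  open RingSolver commutativeSemiring using (solve; _:=_; _:+_; _:*_)
  open SetoidReasoning setoid
  open Exp semiring using (_^_; ^-congʳ)
  open Functions R
  open Sums R
  open Operators R n k k≤n p q ħ τ

  P : List Part
  P = partitions (n ∸ k) k

  ∑-at : ∀ {a} {X : Set a} (xs : List X) f ν → ∑ xs f ν ≡ sum xs (λ x → f x ν)
  ∑-at []       f ν = ≡.refl
  ∑-at (x ∷ xs) f ν = ≡.cong (f x ν +_) (∑-at xs f ν)

  basis-refl : ∀ ν → basis ν ν ≡ 1#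
  basis-refl ν with ν ≟ᴾ ν
  ... | yes _  = ≡.refl
  ... | no ν≢ν = contradiction ≡.refl ν≢ν

  basis-≢ : ∀ {ν μ : Part} → ν ≢ μ → basis ν μ ≡ 0#
  basis-≢ {ν} {μ} ν≢μ with ν ≟ᴾ μ
  ... | yes ν≡μ = contradiction ν≡μ ν≢μ
  ... | no  _   = ≡.refl

  basis-sym : ∀ ν μ → basis ν μ ≡ basis μ ν
  basis-sym ν μ with ν ≟ᴾ μ
  ... | yes ≡.refl = ≡.sym (basis-refl ν)
  ... | no ν≢μ     = ≡.sym (basis-≢ (ν≢μ ∘ ≡.sym))

  sum-basisʳ : ∀ (f : M) μ → sum P (λ ν → f ν * basis ν μ) ≈ f μ
  sum-basisʳ f μ = begin
    sum P (λ ν → f ν * basis ν μ)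
      ≈⟨ sum-single (partitions-unique _ _) (∈-partitions μ) (λ ν → f ν * basis ν μ)
           (λ ν μ≢ν → trans (*-congˡ (reflexive (basis-≢ (μ≢ν ∘ ≡.sym)))) (zeroʳ (f ν))) ⟩
    f μ * basis μ μ  ≈⟨ *-congˡ (reflexive (basis-refl μ)) ⟩
    f μ * 1#         ≈⟨ *-identityʳ (f μ) ⟩
    f μ              ∎

  sum-basisˡ : ∀ (f : M) μ → sum P (λ ν → f ν * basis μ ν) ≈ f μ
  sum-basisˡ f μ = trans (sum-cong P λ ν → *-congˡ (reflexive (basis-sym μ ν))) (sum-basisʳ f μ)

  -- The matrix of `A a b i` from `ν` to `μ`; `B a b i` has the transposed matrix.
  kernel : End → End → Fin k → Part → Part → Carrier
  kernel a b i ν μ = τ (index ν i) * basis ν μ + coefficient a b i μ ν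

  A-kernel : ∀ a b i v μ → A a b i v μ ≈ sum P (λ ν → v ν * kernel a b i ν μ)
  A-kernel a b i v μ = trans (reflexive (∑-at P _ μ)) (sum-cong P λ ν → *-congˡ (+-congˡ
    (trans (reflexive (∑-at P _ μ)) (sum-basisʳ (λ κ → coefficient a b i κ ν) μ))))

  B-kernel : ∀ a b i v κ → B a b i v κ ≈ sum P (λ ν → v ν * kernel a b i κ ν)
  B-kernel a b i v κ = trans (reflexive (∑-at P _ κ)) (sum-cong P λ ν → *-congˡ (+-cong (swap ν)
    (trans (reflexive (∑-at P _ κ)) (sum-basisʳ (λ λ′ → coefficient a b i ν λ′) κ))))
    where
    -- The two indices may differ only where `basis` vanishes.
    swap : ∀ ν → τ (index ν i) * basis ν κ ≈ τ (index κ i) * basis κ ν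
    swap ν with ν ≟ᴾ κ | κ ≟ᴾ ν
    ... | yes ≡.refl | yes _   = refl
    ... | yes ≡.refl | no κ≢κ  = contradiction ≡.refl κ≢κ
    ... | no ν≢ν     | yes ≡.refl = contradiction ≡.refl ν≢ν
    ... | no _       | no _    = trans (zeroʳ _) (sym (zeroʳ _))

  A-cong : ∀ a b i {u v} → u ≈ᴹ v → A a b i u ≈ᴹ A a b i v
  A-cong a b i u≈v μ = trans (A-kernel a b i _ μ)
    (trans (sum-cong P λ ν → *-congʳ (u≈v ν)) (sym (A-kernel a b i _ μ)))

  A-B-adjoint : ∀ a b i u v → sum P (λ κ → u κ * B a b i v κ) ≈ sum P (λ ν → A a b i u ν * v ν)
  A-B-adjoint a b i u v = begin
    sum P (λ κ → u κ * B a b i v κ)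
      ≈⟨ sum-cong P (λ κ → trans (*-congˡ (B-kernel a b i v κ)) (sum-*ˡ P (u κ) _)) ⟩
    sum P (λ κ → sum P (λ ν → u κ * (v ν * kernel a b i κ ν)))
      ≈⟨ sum-swap P P _ ⟩
    sum P (λ ν → sum P (λ κ → u κ * (v ν * kernel a b i κ ν)))
      ≈⟨ sum-cong P (λ ν → trans
           (sum-cong P λ κ → solve 3 (λ x y z → x :* (y :* z) := y :* (x :* z)) refl (u κ) (v ν) _)
           (sym (sum-*ˡ P (v ν) _))) ⟩
    sum P (λ ν → v ν * sum P (λ κ → u κ * kernel a b i κ ν))
      ≈⟨ sum-cong P (λ ν → trans (*-congˡ (sym (A-kernel a b i u ν))) (*-comm _ _)) ⟩
    sum P (λ ν → A a b i u ν * v ν) ∎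

  -- The outermost `B` factor crosses the pairing and becomes the first `A` factor to act, so
  -- `composeUp` is adjoint to `composeDown` over the same indices.
  compose-adjoint : ∀ a b {r} (is : Vec (Fin k) r) u v →
    sum P (λ κ → u κ * composeUp (B a b) is v κ) ≈ sum P (λ κ → composeDown (A a b) is u κ * v κ)
  compose-adjoint a b []       u v = refl
  compose-adjoint a b (i ∷ is) u v = trans (A-B-adjoint a b i u _) (compose-adjoint a b is _ v)

  compose-transpose : ∀ a b {r} (is : Vec (Fin k) r) μ κ →
    composeUp (B a b) is (basis μ) κ ≈ composeDown (A a b) is (basis κ) μ
  compose-transpose a b is μ κ = begin
    composeUp (B a b) is (basis μ) κ
      ≈⟨ sum-basisˡ (composeUp (B a b) is (basis μ)) κ ⟨
    sum P (λ ν → composeUp (B a b) is (basis μ) ν * basis κ ν)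
      ≈⟨ sum-cong P (λ ν → *-comm _ _) ⟩
    sum P (λ ν → basis κ ν * composeUp (B a b) is (basis μ) ν)
      ≈⟨ compose-adjoint a b is (basis κ) (basis μ) ⟩
    sum P (λ ν → composeDown (A a b) is (basis κ) ν * basis μ ν)
      ≈⟨ sum-basisˡ (composeDown (A a b) is (basis κ)) μ ⟩
    composeDown (A a b) is (basis κ) μ ∎

  composeDown-cong : ∀ a b {r} (is : Vec (Fin k) r) {u v} → u ≈ᴹ v →
                     composeDown (A a b) is u ≈ᴹ composeDown (A a b) is v
  composeDown-cong a b []       u≈v = u≈v
  composeDown-cong a b (i ∷ is) u≈v = composeDown-cong a b is (A-cong a b i u≈v)

  n≡ : n ≡ n ∸ k ℕ.+ k
  n≡ = ≡.sym (ℕ.m∸n+n≡m k≤n)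

  config : Part → Config n
  config ν = proj₁ (encode n (n ∸ k) n≡ (rows-descending ν))

  code : ∀ ν → Code (config ν) (n ∸ k) (rows ν)
  code ν = proj₂ (encode n (n ∸ k) n≡ (rows-descending ν))

  config-injective : ∀ {ν μ} → config ν ≡ config μ → ν ≡ μ
  config-injective {ν} {μ} e =
    rows-injective (code-functional (code ν) (≡.subst (λ c → Code c _ (rows μ)) (≡.sym e) (code μ)))

  config-surjective : ∀ c → particles c ≡ k → ∃ λ ν → config ν ≡ c
  config-surjective c e = go (decode c)
    where
    go : (∃ λ m → ∃ λ (X : Vec ℕ (particles c)) → Code c m X) → ∃ λ ν → config ν ≡ c
    go (m , X , C) rewrite e
      -- With `k` particles on `n` sites the number of holes must be `n ∸ k`.
      with ≡.refl ← ℕ.+-cancelʳ-≡ k m (n ∸ k) (≡.trans (≡.sym (code-size C)) n≡)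
      with ν , ≡.refl ← rows-surjective (code-descending C) = ν , code-injective (code ν) C

  -- The jump operators number sites by natural numbers; `0#` is a default beyond the `n` sites.
  τℕ : ℕ → Carrier
  τℕ s with s ℕ.<? n
  ... | yes s<n = τ (fromℕ< s<n)
  ... | no  _   = 0#

  τℕ-toℕ : ∀ x → τℕ (toℕ x) ≡ τ x
  τℕ-toℕ x with toℕ x ℕ.<? n
  ... | yes x<n = ≡.cong τ (Fin.fromℕ<-toℕ x x<n)
  ... | no  x≮n = contradiction (Fin.toℕ<n x) x≮n

  τ-index : ∀ ν i → τℕ (position (rows ν) i) ≡ τ (index ν i)
  τ-index ν i = ≡.trans (≡.cong τℕ (≡.sym index≡)) (τℕ-toℕ (index ν i))
    where
    index≡ : toℕ (index ν i) ≡ position (rows ν) i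
    index≡ = ≡.trans (Fin.toℕ-fromℕ< _)
      (≡.trans (≡.cong (ℕ._+ _) (≡.sym (lookup-rows ν i))) (≡.sym (position≡ (rows ν) i)))

  jumpFactor : End → ℕ → ℕ → Carrier
  jumpFactor h x y = ħ - (p - q) * τℕ y
  jumpFactor t x y = ħ - (p - q) * τℕ x

  module _ (b : End) where

    open Jumps R p q τℕ (jumpFactor b)
    open Kernels R p q τℕ (jumpFactor b)

    basis≈δ : ∀ ν μ → basis ν μ ≈ δ (config ν) (config μ)
    basis≈δ ν μ with ν ≟ᴾ μ
    ... | yes ≡.refl = reflexive (≡.sym (δ-refl (config ν)))
    ... | no ν≢μ     = reflexive (≡.sym (δ-≢ (ν≢μ ∘ config-injective)))

    moves : End → ℕ → Op n
    moves h = H k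
    moves t = T

    moves-linear : ∀ a i → Linear (moves a i)
    moves-linear h = H-linear k
    moves-linear t = T-linear

    moves-local : ∀ a i {u v : Fun n} c → (∀ d → particles d ≡ particles c → u d ≈ v d) →
                  moves a i u c ≈ moves a i v c
    moves-local h = H-local k
    moves-local t = T-local

    weight≈ : ∀ {μ ν : Part} (η : IsRibbon μ ν) →
              jumpWeight (rows ν) (rows μ) (headRow η) (tailRow η) ≈ weight b η
    weight≈ {μ} {ν} η = *-cong (*-cong (factor b) (^-congʳ p ht≡)) (^-congʳ q wd≡)
      where
      S = ribbon⇒shape η
      factor : ∀ b → jumpFactor b (position (rows ν) (tailRow η)) (position (rows μ) (headRow η))
                     ≈ ħ - (p - q) * τ (endIndex b η)
      factor h = +-congˡ (-‿cong (*-congˡ (reflexive (τ-index μ (headRow η)))))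
      factor t = +-congˡ (-‿cong (*-congˡ (reflexive (τ-index ν (tailRow η)))))
      ht≡ : toℕ (tailRow η) ∸ toℕ (headRow η) ≡ ht μ ν ∸ 1
      ht≡ = ≡.trans (≡.sym (suc∸∸1 (toℕ (tailRow η)) (toℕ (headRow η))))
                    (≡.cong (_∸ 1) (≡.sym (shape-ht {μ = μ} {ν} S)))
      wd≡ : lookup (rows μ) (headRow η) ∸ lookup (rows ν) (tailRow η) ∸ 1 ≡ wd μ ν ∸ 1
      wd≡ = ≡.cong (_∸ 1) (≡.trans (≡.cong₂ _∸_ (lookup-rows μ _) (lookup-rows ν _))
                                      (≡.sym (shape-wd {μ = μ} {ν} S)))

    moves-ribbon : ∀ a {μ ν : Part} (η : IsRibbon μ ν) (i : Fin k) →
      moves a (toℕ i) (δ (config ν)) (config μ) ≈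
      (if toℕ i ≡ᵇ toℕ (endRow a η) then jumpWeight (rows ν) (rows μ) (headRow η) (tailRow η) else 0#)
    moves-ribbon h {μ} {ν} η i = H-move (code ν) (code μ) (ribbon⇒move η) (toℕ i)
    moves-ribbon t {μ} {ν} η i = T-move (code ν) (code μ) (ribbon⇒move η) (toℕ i)

    moves-stay : ∀ a ν i → moves a (toℕ i) (δ (config ν)) (config ν) ≈ τ (index ν i)
    moves-stay h ν i = trans (H-stay (code ν) i) (reflexive (τ-index ν i))
    moves-stay t ν i = trans (T-stay (code ν) i) (reflexive (τ-index ν i))

    moves-¬ribbon : ∀ a {μ ν} → ν ≢ μ → ¬ IsRibbon μ ν → ∀ i → moves a i (δ (config ν)) (config μ) ≈ 0#
    moves-¬ribbon h {μ} {ν} ν≢μ ¬η i = H-¬move (code ν) (code μ)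
      (ν≢μ ∘ rows-injective {ν = ν} {μ}) (λ _ _ J → ¬η (move⇒ribbon {μ = μ} {ν} J)) i
    moves-¬ribbon t {μ} {ν} ν≢μ ¬η i = T-¬move (code ν) (code μ)
      (ν≢μ ∘ rows-injective {ν = ν} {μ}) (λ _ _ J → ¬η (move⇒ribbon {μ = μ} {ν} J)) i

    ribbon-≢ : ∀ {μ ν : Part} → IsRibbon μ ν → ν ≢ μ
    ribbon-≢ η ν≡μ with _ , ν≤x , x<μ ← IsRibbon.nonempty η =
      ℕ.<⇒≱ x<μ (≡.subst (λ κ → part κ _ ≤ _) ν≡μ ν≤x)

    moved : ∀ {a x} {i : Fin k} {μ ν : Part} {η : IsRibbon μ ν} →
      (if toℕ i ≡ᵇ toℕ (endRow a η) then jumpWeight (rows ν) (rows μ) (headRow η) (tailRow η) else 0#) ≈ x →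
      τ (index ν i) * basis ν μ + x ≈ moves a (toℕ i) (δ (config ν)) (config μ)
    moved {a} {x} {i} {μ} {ν} {η} ≈x = begin
      τ (index ν i) * basis ν μ + x  ≈⟨ +-congʳ (*-congˡ (reflexive (basis-≢ (ribbon-≢ η)))) ⟩
      τ (index ν i) * 0# + x         ≈⟨ +-congʳ (zeroʳ _) ⟩
      0# + x                         ≈⟨ +-identityˡ x ⟩
      x                              ≈⟨ trans (moves-ribbon a η i) ≈x ⟨
      moves a (toℕ i) (δ (config ν)) (config μ) ∎

    kernel≈ : ∀ a i ν μ → kernel a b i ν μ ≈ moves a (toℕ i) (δ (config ν)) (config μ)
    kernel≈ a i ν μ with isRibbon? μ ν
    ... | no ¬η with ν ≟ᴾ μ
    ...   | yes ≡.refl = trans (+-identityʳ _) (trans (*-identityʳ _) (sym (moves-stay a ν i)))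
    ...   | no ν≢μ     = trans (+-identityʳ _) (trans (zeroʳ _) (sym (moves-¬ribbon a ν≢μ ¬η (toℕ i))))
    kernel≈ a i ν μ | yes η with endRow a η Fin.≟ i
    ... | yes ≡.refl = moved {a} {η = η} (trans (reflexive (if-≡ᵇ-refl (toℕ i))) (weight≈ η))
    ... | no  e≢i    = moved {a} {η = η} (reflexive (if-≡ᵇ-≢ (e≢i ∘ ≡.sym ∘ Fin.toℕ-injective)))

    -- The function `u` is expanded in the `δ (config ν)`. The expansion is valid at configurations
    -- with `k` particles, and `moves-local` shows that this suffices.
    A-moves : ∀ a i u μ → A a b i (u ∘ config) μ ≈ moves a (toℕ i) u (config μ)
    A-moves a i u μ = begin
      A a b i (u ∘ config) μ
        ≈⟨ A-kernel a b i _ μ ⟩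
      sum P (λ ν → u (config ν) * kernel a b i ν μ)
        ≈⟨ sum-cong P (λ ν → *-congˡ (kernel≈ a i ν μ)) ⟩
      sum P (λ ν → u (config ν) * moves a (toℕ i) (δ (config ν)) (config μ))
        ≈⟨ linear-sum (moves-linear a (toℕ i)) P (u ∘ config) (δ ∘ config) (config μ) ⟨
      moves a (toℕ i) (λ c → sum P (λ ν → u (config ν) * δ (config ν) c)) (config μ)
        ≈⟨ moves-local a (toℕ i) (config μ) expand ⟩
      moves a (toℕ i) u (config μ) ∎
      where
      expand : ∀ c → particles c ≡ particles (config μ) → sum P (λ ν → u (config ν) * δ (config ν) c) ≈ u c
      expand c e with ν , ≡.refl ← config-surjective c (≡.trans e (code-particles (code μ))) = trans
        (sum-cong P λ κ → *-congˡ (sym (basis≈δ κ ν))) (sum-basisʳ (u ∘ config) ν)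

    -- The embedding `ι` of the remaining indices lets the induction drop index 0 by passing to
    -- `ι ∘ suc`, in step with the recursion of `e₁`.
    sum-composeDown : ∀ a {k′} (ι : Fin k′ → Fin k) {F : ℕ → Op n} → (∀ i → Linear (F i)) →
      (∀ i u μ → A a b (ι i) (u ∘ config) μ ≈ F (toℕ i) u (config μ)) → ∀ r u ν →
      sum (increasing k′ r) (λ is → composeDown (A a b) (Vec.map ι is) (u ∘ config) ν)
      ≈ e₁ F k′ r u (config ν)
    sum-composeDown a {k′}     ι L A≈F zero    u ν = +-identityʳ _
    sum-composeDown a {zero}   ι L A≈F (suc r) u ν = refl
    sum-composeDown a {suc k′} ι {F} L A≈F (suc r) u ν = begin
      sum (increasing (suc k′) (suc r)) (λ is → composeDown (A a b) (Vec.map ι is) (u ∘ config) ν)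
        ≈⟨ sum-increasing k′ r _ ⟩
      sum (increasing k′ r) (λ is →
          composeDown (A a b) (Vec.map ι (Vec.map suc is)) (A a b (ι zero) (u ∘ config)) ν)
        + sum (increasing k′ (suc r)) (λ is → composeDown (A a b) (Vec.map ι (Vec.map suc is)) (u ∘ config) ν)
        ≈⟨ +-cong (sum-cong (increasing k′ r) λ is → trans
                     (composeDown-cong a b (Vec.map ι (Vec.map suc is)) (A≈F zero u) ν) (reindex is (F 0 u)))
                  (sum-cong (increasing k′ (suc r)) λ is → reindex is u) ⟩
      sum (increasing k′ r) (λ is → composeDown (A a b) (Vec.map (ι ∘ suc) is) (F 0 u ∘ config) ν)
        + sum (increasing k′ (suc r)) (λ is → composeDown (A a b) (Vec.map (ι ∘ suc) is) (u ∘ config) ν)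
        ≈⟨ +-cong (sum-composeDown a (ι ∘ suc) (L ∘ suc) (A≈F ∘ suc) r (F 0 u) ν)
                  (sum-composeDown a (ι ∘ suc) (L ∘ suc) (A≈F ∘ suc) (suc r) u ν) ⟩
      e₁ (F ∘ suc) k′ r (F 0 u) (config ν) + e₁ (F ∘ suc) k′ (suc r) u (config ν) ∎
      where
      reindex : ∀ {r} (is : Vec (Fin k′) r) v →
                composeDown (A a b) (Vec.map ι (Vec.map suc is)) (v ∘ config) ν
                ≈ composeDown (A a b) (Vec.map (ι ∘ suc) is) (v ∘ config) ν
      reindex is v = reflexive
        (≡.cong (λ js → composeDown (A a b) js (v ∘ config) ν) (≡.sym (Vec.map-∘ ι suc is)))

    ∑-composeDown : ∀ a r ν μ → ∑ (increasing k r) (λ is → composeDown (A a b) is (basis ν)) μ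
                    ≈ e₁ (moves a) k r (δ (config ν)) (config μ)
    ∑-composeDown a r ν μ = begin
      ∑ (increasing k r) (λ is → composeDown (A a b) is (basis ν)) μ
        ≡⟨ ∑-at (increasing k r) _ μ ⟩
      sum (increasing k r) (λ is → composeDown (A a b) is (basis ν) μ)
        ≈⟨ sum-cong (increasing k r) (λ is → trans (composeDown-cong a b is (basis≈δ ν) μ)
             (reflexive (≡.cong (λ js → composeDown (A a b) js (δ (config ν) ∘ config) μ)
               (≡.sym (Vec.map-id is))))) ⟩
      sum (increasing k r) (λ is → composeDown (A a b) (Vec.map id is) (δ (config ν) ∘ config) μ)
        ≈⟨ sum-composeDown a id (moves-linear a) (A-moves a) r (δ (config ν)) μ ⟩
      e₁ (moves a) k r (δ (config ν)) (config μ) ∎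

    A-theorem : ∀ r ν → ∑ (increasing k r) (λ is → composeDown (A h b) is (basis ν))
                        ≈ᴹ ∑ (increasing k r) (λ is → composeDown (A t b) is (basis ν))
    A-theorem r ν μ = begin
      ∑ (increasing k r) (λ is → composeDown (A h b) is (basis ν)) μ  ≈⟨ ∑-composeDown h r ν μ ⟩
      e₁ (H k) k r (δ (config ν)) (config μ)                          ≈⟨ e₁T≋e₁H k r _ (config μ) ⟨
      e₁ T k r (δ (config ν)) (config μ)                              ≈⟨ ∑-composeDown t r ν μ ⟨
      ∑ (increasing k r) (λ is → composeDown (A t b) is (basis ν)) μ  ∎

    ∑-transpose : ∀ a r μ κ → ∑ (increasing k r) (λ is → composeUp (B a b) is (basis μ)) κ
                              ≈ ∑ (increasing k r) (λ is → composeDown (A a b) is (basis κ)) μ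
    ∑-transpose a r μ κ = begin
      ∑ (increasing k r) (λ is → composeUp (B a b) is (basis μ)) κ
        ≡⟨ ∑-at (increasing k r) _ κ ⟩
      sum (increasing k r) (λ is → composeUp (B a b) is (basis μ) κ)
        ≈⟨ sum-cong (increasing k r) (λ is → compose-transpose a b is μ κ) ⟩
      sum (increasing k r) (λ is → composeDown (A a b) is (basis κ) μ)
        ≡⟨ ∑-at (increasing k r) _ μ ⟨
      ∑ (increasing k r) (λ is → composeDown (A a b) is (basis κ)) μ ∎

    B-theorem : ∀ r μ → ∑ (increasing k r) (λ is → composeUp (B h b) is (basis μ))
                        ≈ᴹ ∑ (increasing k r) (λ is → composeUp (B t b) is (basis μ))
    B-theorem r μ κ = trans (∑-transpose h r μ κ) (trans (A-theorem r κ μ) (sym (∑-transpose t r μ κ)))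

theoremA1 : {c ℓ : Level} (R : CommutativeRing c ℓ) (n k : ℕ) (k≤n : k ≤ n)
    (p q ħ : CommutativeRing.Carrier R)
    (τ : Fin n → CommutativeRing.Carrier R) →
    let open Operators R n k k≤n p q ħ τ in
    (ν μ : Part) (r : ℕ) → r ≤ k →
    (∑ (increasing k r) (λ is → composeDown (A h h) is (basis ν))
    ≈ᴹ ∑ (increasing k r) (λ is → composeDown (A t h) is (basis ν)))
    × (∑ (increasing k r) (λ is → composeDown (A h t) is (basis ν))
    ≈ᴹ ∑ (increasing k r) (λ is → composeDown (A t t) is (basis ν)))
    × (∑ (increasing k r) (λ is → composeUp (B h h) is (basis μ))
    ≈ᴹ ∑ (increasing k r) (λ is → composeUp (B t h) is (basis μ)))
    × (∑ (increasing k r) (λ is → composeUp (B h t) is (basis μ))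
    ≈ᴹ ∑ (increasing k r) (λ is → composeUp (B t t) is (basis μ)))
theoremA1 R n k k≤n p q ħ τ ν μ r _ = A-theorem h r ν , A-theorem t r ν , B-theorem h r μ , B-theorem t r μ
  where open Assembly R n k k≤n p q ħ τ
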